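{- Let $n\geq 5$ and let $f:E(K_n)\to\{ -1,1\}$ be a weighting with $|f^{ -1}(1)|=h(n)-1$, where $h(n)=n+1$ if $n\equiv 0\pmod 4$ and $h(n)=n$ otherwise. Then there is no copy $H$ of $K_4$ in $K_n$ with $\sum_{e\in E(H)}f(e)=0$ if and only if the graph on vertex set $V(K_n)$ with edge set $f^{ -1}(1)$ is isomorphic to the disjoint union $J\cup\bigcup_{i=1}^{q}C_4$ of $J$ and $q$ copies of $C_4$, where $J\in\{\emptyset,K_1,K_2,P_2\}$ and $q=\lfloor n/4\rfloor$.
   Context: $K_n$ is the complete graph on $n$ vertices. $C_4$ is the cycle with 4 edges, $P_2$ the path with 2 edges, $K_1$ a single vertex, $K_2$ a single edge, and $\emptyset$ the empty graph (no vertices). -}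

module Defs where

open import Data.Nat using (ℕ; zero; suc; _%_; _≡ᵇ_; _∸_)
open import Data.Bool using (if_then_else_)
open import Data.Fin using (Fin; _<_; toℕ)
open import Data.Fin.Properties using (<-trans)
open import Data.Integer using (ℤ; _+_; +_; -[1+_])
open import Data.Sign using (Sign)
open import Data.Product using (Σ; ∃; _×_; _,_)
open import Data.Sum using (_⊎_)
open import Data.Empty using (⊥)
open import Data.Unit using (⊤)
open import Relation.Binary.PropositionalEquality using (_≡_; _≢_)
open import Relation.Nullary using (¬_)
open import Function.Bundles using (_↔_; _⇔_; Inverse)

-- An edge of K_n: an unordered pair {lo, hi} of distinct vertices, stored with lo < hi.
record Edge (n : ℕ) : Set where
  constructor edge
  field
    lo hi : Fin n
    lo<hi : lo < hi

-- A weighting f : E(K_n) → {-1, 1}; Sign.+ stands for 1, Sign.- for -1.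
Weighting : ℕ → Set
Weighting n = Edge n → Sign

signℤ : Sign → ℤ
signℤ Sign.+ = + 1
signℤ Sign.- = -[1+ 0 ]

-- h(n) = n+1 if n ≡ 0 (mod 4), and n otherwise.
h : ℕ → ℕ
h n = if (n % 4) ≡ᵇ 0 then suc n else n

-- f^{-1}(1) has exactly m elements.
PosCount : ∀ {n} → Weighting n → ℕ → Set
PosCount {n} f m = Σ (Edge n) (λ e → f e ≡ Sign.+) ↔ Fin m

-- Weight of the copy of K_4 on vertices a < b < c < d.
K4weight : ∀ {n} → Weighting n → (a b c d : Fin n) → a < b → b < c → c < d → ℤ
K4weight f a b c d ab bc cd =
  signℤ (f (edge a b ab)) + signℤ (f (edge a c ac)) + signℤ (f (edge a d ad))
  + signℤ (f (edge b c bc)) + signℤ (f (edge b d bd)) + signℤ (f (edge c d cd))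
  where
    ac = <-trans ab bc
    bd = <-trans bc cd
    ad = <-trans ab bd

-- Some copy of K_4 in K_n has zero total weight (copies of K_4 = 4-subsets {a<b<c<d}).
ZeroSumK4 : ∀ {n} → Weighting n → Set
ZeroSumK4 {n} f = Σ (Fin n) λ a → Σ (Fin n) λ b → Σ (Fin n) λ c → Σ (Fin n) λ d →
  Σ (a < b) λ ab → Σ (b < c) λ bc → Σ (c < d) λ cd → K4weight f a b c d ab bc cd ≡ + 0

-- Simple graphs given by a vertex type and an adjacency relation.
record Graph : Set₁ where
  field
    Vertex : Set
    Adj    : Vertex → Vertex → Set
open Graph public

-- The graph on V(K_n) with edge set f^{-1}(1).
posGraph : ∀ {n} → Weighting n → Graph
posGraph {n} f = record
  { Vertex = Fin n
  ; Adj = λ i j → (Σ (i < j) λ p → f (edge i j p) ≡ Sign.+)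
                ⊎ (Σ (j < i) λ p → f (edge j i p) ≡ Sign.+) }

-- Graph isomorphism.
_≅_ : Graph → Graph → Set
G ≅ H = Σ (Vertex G ↔ Vertex H) λ φ →
  ∀ u v → Adj G u v ⇔ Adj H (Inverse.to φ u) (Inverse.to φ v)

-- Disjoint union.
_⊕_ : Graph → Graph → Graph
G ⊕ H = record
  { Vertex = Vertex G ⊎ Vertex H
  ; Adj = adj }
  where
    adj : Vertex G ⊎ Vertex H → Vertex G ⊎ Vertex H → Set
    adj (Data.Sum.inj₁ x) (Data.Sum.inj₁ y) = Adj G x y
    adj (Data.Sum.inj₂ x) (Data.Sum.inj₂ y) = Adj H x y
    adj _ _ = ⊥

emptyGraph : Graph
emptyGraph = record { Vertex = ⊥ ; Adj = λ _ _ → ⊥ }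

K₁ : Graph
K₁ = record { Vertex = ⊤ ; Adj = λ _ _ → ⊥ }

K₂ : Graph
K₂ = record { Vertex = Fin 2 ; Adj = λ i j → i ≢ j }

-- Path with 2 edges: 0 - 1 - 2.
P₂ : Graph
P₂ = record { Vertex = Fin 3
            ; Adj = λ i j → (suc (toℕ i) ≡ toℕ j) ⊎ (suc (toℕ j) ≡ toℕ i) }

-- Cycle with 4 edges: 0 - 1 - 2 - 3 - 0.
C₄ : Graph
C₄ = record { Vertex = Fin 4
            ; Adj = λ i j → (suc (toℕ i) % 4 ≡ toℕ j) ⊎ (suc (toℕ j) % 4 ≡ toℕ i) }

-- Disjoint union of q copies of G.
copies : ℕ → Graph → Graph
copies zero G = emptyGraph
copies (suc q) G = G ⊕ copies q G

-- Proof of the characterisation of the ±1-weightings of E(K_n), n ≥ 5, with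
-- h(n) − 1 positive edges and no zero-sum K₄.
--
-- A K₄ has weight 0 exactly when three of its six edges are positive, so the
-- statement is about the graph G of positive edges: G has no four vertices
-- spanning exactly three edges iff G ≅ J ⊕ q·C₄ with J ∈ {∅, K₁, K₂, P₂}.
--
-- Forward direction (graph theory). G has h(n) − 1 ∈ {n, n − 1} edges, so
-- its degree sum is at most 2n. A triangle would force every vertex to have
-- degree ≥ 2 and one of them degree ≥ 3 (this uses a fifth vertex), which is
-- too many edges; without triangles a vertex of degree 3 spans exactly three
-- edges with its neighbours. So all degrees are ≤ 2, and any 2-path through
-- degree-2 vertices closes into a 4-cycle that is a whole component. Counting
-- the defects 2 − deg v (their sum is 0 or 2) locates J, the components of
-- degree-2 vertices are peeled off one square at a time, and counting
-- vertices gives q = n / 4.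
--
-- Backward direction. In J ⊕ q·C₄ two vertices are adjacent iff they lie in
-- the same component on different sides, each side having at most two
-- vertices; for four such vertices an exhaustive check of the possible
-- patterns shows that they never span exactly three edges.

module Submission where

open import Defs

open import Data.Nat as ℕ using (ℕ; zero; suc; _+_; _*_; _∸_; _%_; _/_; z≤n; s≤s; _≤_; _<_)
import Data.Nat.Properties as ℕP
open import Data.Fin as Fin using (Fin; toℕ) renaming (zero to fz; suc to fs)
import Data.Fin.Properties as FinP
open import Data.Bool using (Bool; true; false; T; not; _∧_; _∨_; _xor_)
open import Data.Product as Product using (Σ; _×_; _,_; proj₁; proj₂)
open import Data.Sum as Sum using (_⊎_; inj₁; inj₂; [_,_]′)
open import Data.Sum.Function.Propositional using (_⊎-↔_)
open import Data.Empty using (⊥; ⊥-elim)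
open import Data.Unit using (tt)
open import Function using (_∘_)
open import Data.Vec.Functional using (_∷_; [])
open import Function.Bundles using (_↔_; _⇔_; mk↔ₛ′; mk⇔; Equivalence; Inverse)
open import Function.Properties.Inverse using (↔-refl; ↔-trans; ↔-sym)
open import Data.Fin.Permutation using (↔⇒≡)
open import Function.Construct.Composition using (_⇔-∘_)
open import Function.Construct.Identity using (⇔-id)
open import Function.Construct.Symmetry using (⇔-sym)
open import Relation.Binary.PropositionalEquality
open import Relation.Nullary using (¬_; ¬?; Dec; yes; no; does)
open import Relation.Nullary.Decidable as Dec using (dec-true; _⊎-dec_; _×-dec_; _→-dec_)
import Data.Integer as ℤ
open import Axiom.UniquenessOfIdentityProofs using (module Decidable⇒UIP)
import Data.Bool.Properties as BoolP
open import Data.Sign using (Sign)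
import Data.Sign.Properties as SignP
open import Relation.Binary.Definitions using (Tri; tri<; tri≈; tri>)
open import Algebra.Properties.CommutativeMonoid.Sum ℕP.+-0-commutativeMonoid using (sum; sum-cong-≗; ∑-distrib-+)
open import Data.Nat.Solver using (module +-*-Solver)
open +-*-Solver using (solve; _:=_; _:+_; _:*_; con)
import Data.Nat.DivMod as DivMod
import Data.Nat.Divisibility as Div
open import Algebra.Properties.CommutativeSemigroup ℕP.+-commutativeSemigroup using (x∙yz≈y∙xz)

false≢true : false ≢ true
false≢true ()

-- The indicator 1/0 of a boolean.
χ : Bool → ℕ
χ true = 1
χ false = 0

χ≤1 : ∀ b → χ b ≤ 1
χ≤1 true = s≤s z≤n
χ≤1 false = z≤n

χ-mono : ∀ {a b} → (a ≡ true → b ≡ true) → χ a ≤ χ b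
χ-mono {false} _ = z≤n
χ-mono {true} a⇒b rewrite a⇒b refl = s≤s z≤n

χ≢0⇒true : ∀ {b} → χ b ≢ 0 → b ≡ true
χ≢0⇒true {true} _ = refl
χ≢0⇒true {false} nz = ⊥-elim (nz refl)

-- zeroAt g i agrees with g except that its value at i is 0; it lets us
-- pull one summand out of a finite sum.
zeroAt : ∀ {n} → (Fin n → ℕ) → Fin n → Fin n → ℕ
zeroAt g fz fz = 0
zeroAt g fz (fs j) = g (fs j)
zeroAt g (fs i) fz = g fz
zeroAt g (fs i) (fs j) = zeroAt (g ∘ fs) i j

zeroAt-self : ∀ {n} (g : Fin n → ℕ) i → zeroAt g i i ≡ 0
zeroAt-self g fz = refl
zeroAt-self g (fs i) = zeroAt-self (g ∘ fs) i

zeroAt-other : ∀ {n} (g : Fin n → ℕ) {i j} → j ≢ i → zeroAt g i j ≡ g j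
zeroAt-other g {fz} {fz} j≢i = ⊥-elim (j≢i refl)
zeroAt-other g {fz} {fs j} j≢i = refl
zeroAt-other g {fs i} {fz} j≢i = refl
zeroAt-other g {fs i} {fs j} j≢i = zeroAt-other (g ∘ fs) (j≢i ∘ cong fs)

sum-zeroAt : ∀ {n} (g : Fin n → ℕ) i → sum g ≡ g i + sum (zeroAt g i)
sum-zeroAt g fz = refl
sum-zeroAt g (fs i) = trans (cong (g fz +_) (sum-zeroAt (g ∘ fs) i)) (x∙yz≈y∙xz (g fz) (g (fs i)) _)

-- A sum dominates any one, two or three of its (distinct) summands.
sum-≥₁ : ∀ {n} (g : Fin n → ℕ) i → g i ≤ sum g
sum-≥₁ g i rewrite sum-zeroAt g i = ℕP.m≤m+n (g i) _

sum-≥₂ : ∀ {n} (g : Fin n → ℕ) {i j} → j ≢ i → g i + g j ≤ sum g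
sum-≥₂ g {i} {j} j≢i rewrite sum-zeroAt g i =
  ℕP.+-monoʳ-≤ (g i) (subst (_≤ sum (zeroAt g i)) (zeroAt-other g j≢i) (sum-≥₁ (zeroAt g i) j))

sum-≥₃ : ∀ {n} (g : Fin n → ℕ) {i j k} → j ≢ i → k ≢ i → k ≢ j → g i + g j + g k ≤ sum g
sum-≥₃ g {i} {j} {k} j≢i k≢i k≢j rewrite sum-zeroAt g i | ℕP.+-assoc (g i) (g j) (g k) =
  ℕP.+-monoʳ-≤ (g i) (subst₂ (λ a b → a + b ≤ sum (zeroAt g i))
    (zeroAt-other g j≢i) (zeroAt-other g k≢i) (sum-≥₂ (zeroAt g i) k≢j))

-- A non-zero sum has a non-zero summand; a zero sum has only zero summands.
nonzero-summand : ∀ {n} (g : Fin n → ℕ) → sum g ≢ 0 → Σ (Fin n) λ i → g i ≢ 0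
nonzero-summand {zero} g nz = ⊥-elim (nz refl)
nonzero-summand {suc n} g nz with g fz ℕ.≟ 0
... | no g0≢0 = fz , g0≢0
... | yes g0≡0 with nonzero-summand (g ∘ fs) (λ rest≡0 → nz (cong₂ _+_ g0≡0 rest≡0))
...   | i , gi≢0 = fs i , gi≢0

zero-sum⇒zero : ∀ {n} (g : Fin n → ℕ) → sum g ≡ 0 → ∀ i → g i ≡ 0
zero-sum⇒zero g g≡0 i = ℕP.n≤0⇒n≡0 (subst (g i ≤_) g≡0 (sum-≥₁ g i))

-- If all summands are at most 1 and the sum is at least 2 (resp. 3), then
-- besides one (resp. two) given indices there is a further non-zero summand.
second-summand : ∀ {n} (g : Fin n → ℕ) {i} → g i ≤ 1 → 2 ≤ sum g →
                 Σ (Fin n) λ j → j ≢ i × g j ≢ 0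
second-summand g {i} gi≤1 2≤sum with nonzero-summand (zeroAt g i) rest≢0
  where
  rest≢0 : sum (zeroAt g i) ≢ 0
  rest≢0 rest≡0 = ℕP.<-irrefl refl (ℕP.≤-trans 2≤sum (begin
    sum g                     ≡⟨ sum-zeroAt g i ⟩
    g i + sum (zeroAt g i)    ≡⟨ cong (g i +_) rest≡0 ⟩
    g i + 0                   ≡⟨ ℕP.+-identityʳ (g i) ⟩
    g i                       ≤⟨ gi≤1 ⟩
    1                         ∎))
    where open ℕP.≤-Reasoning
... | j , gj≢0 = j , j≢i , subst (_≢ 0) (zeroAt-other g j≢i) gj≢0
  where
  j≢i : j ≢ i
  j≢i refl = gj≢0 (zeroAt-self g i)

third-summand : ∀ {n} (g : Fin n → ℕ) {i j} → g i ≤ 1 → g j ≤ 1 → j ≢ i → 3 ≤ sum g →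
                Σ (Fin n) λ k → k ≢ i × k ≢ j × g k ≢ 0
third-summand g {i} {j} gi≤1 gj≤1 j≢i 3≤sum with second-summand (zeroAt g i) zeroAt-gj≤1 2≤rest
  where
  zeroAt-gj≤1 : zeroAt g i j ≤ 1
  zeroAt-gj≤1 = subst (_≤ 1) (sym (zeroAt-other g j≢i)) gj≤1
  2≤rest : 2 ≤ sum (zeroAt g i)
  2≤rest = ℕP.+-cancelˡ-≤ 1 2 _ (ℕP.≤-trans 3≤sum (begin
    sum g                    ≡⟨ sum-zeroAt g i ⟩
    g i + sum (zeroAt g i)   ≤⟨ ℕP.+-monoˡ-≤ _ gi≤1 ⟩
    1 + sum (zeroAt g i)     ∎))
    where open ℕP.≤-Reasoning
... | k , k≢j , gk≢0 = k , k≢i , k≢j , subst (_≢ 0) (zeroAt-other g k≢i) gk≢0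
  where
  k≢i : k ≢ i
  k≢i refl = gk≢0 (zeroAt-self g i)

-- Monotonicity of sums, strict as soon as one summand grows strictly.
sum-mono : ∀ {n} {g g′ : Fin n → ℕ} → (∀ i → g i ≤ g′ i) → sum g ≤ sum g′
sum-mono {zero} le = z≤n
sum-mono {suc n} le = ℕP.+-mono-≤ (le fz) (sum-mono (le ∘ fs))

sum-strict : ∀ {n} {g g′ : Fin n → ℕ} → (∀ i → g i ≤ g′ i) → ∀ j → g j < g′ j → sum g < sum g′
sum-strict {g = g} {g′} le j gj<g′j rewrite sum-zeroAt g j | sum-zeroAt g′ j =
  ℕP.+-mono-<-≤ gj<g′j (sum-mono zeroAt-le)
  where
  zeroAt-le : ∀ i → zeroAt g j i ≤ zeroAt g′ j i
  zeroAt-le i with i FinP.≟ j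
  ... | yes refl = ℕP.≤-reflexive (trans (zeroAt-self g j) (sym (zeroAt-self g′ j)))
  ... | no i≢j = subst₂ _≤_ (sym (zeroAt-other g i≢j)) (sym (zeroAt-other g′ i≢j)) (le i)

sum-const : ∀ n c → sum {n} (λ _ → c) ≡ n * c
sum-const zero c = refl
sum-const (suc n) c = cong (c +_) (sum-const n c)

-- Counting: a Σ-type over Fin n whose i-th fibre has k i elements has
-- sum k elements, and a proposition decided by b has χ b elements.
Σ-↔-sum : ∀ {n} {A : Fin n → Set} (k : Fin n → ℕ) → (∀ i → A i ↔ Fin (k i)) →
          Σ (Fin n) A ↔ Fin (sum k)
Σ-↔-sum {zero} k e = mk↔ₛ′ (λ { (() , _) }) (λ ()) (λ ()) (λ { (() , _) })
Σ-↔-sum {suc n} {A} k e =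
  ↔-trans split (↔-trans (e fz ⊎-↔ Σ-↔-sum (k ∘ fs) (e ∘ fs)) (↔-sym (FinP.+↔⊎ {k fz})))
  where
  split : Σ (Fin (suc n)) A ↔ (A fz ⊎ Σ (Fin n) (A ∘ fs))
  split = mk↔ₛ′ to from to∘from from∘to
    where
    to : Σ (Fin (suc n)) A → A fz ⊎ Σ (Fin n) (A ∘ fs)
    to (fz , x) = inj₁ x
    to (fs i , x) = inj₂ (i , x)
    from : A fz ⊎ Σ (Fin n) (A ∘ fs) → Σ (Fin (suc n)) A
    from (inj₁ x) = fz , x
    from (inj₂ (i , x)) = fs i , x
    to∘from : ∀ y → to (from y) ≡ y
    to∘from (inj₁ x) = refl
    to∘from (inj₂ (i , x)) = refl
    from∘to : ∀ y → from (to y) ≡ y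
    from∘to (fz , x) = refl
    from∘to (fs i , x) = refl

prop-↔-χ : ∀ {P : Set} {b : Bool} → (∀ (x y : P) → x ≡ y) → P ⇔ (b ≡ true) → P ↔ Fin (χ b)
prop-↔-χ {b = true} irr P⇔ = mk↔ₛ′ (λ _ → fz) (λ _ → Equivalence.from P⇔ refl) (λ { fz → refl ; (fs ()) }) (λ _ → irr _ _)
prop-↔-χ {P} {b = false} irr P⇔ = mk↔ₛ′ absurd (λ ()) (λ ()) (λ p → absurd p)
  where
  absurd : ∀ {B : Set} → P → B
  absurd p with () ← Equivalence.to P⇔ p

-- Fewer than n given elements of Fin n leave some element uncovered.
outside : ∀ {k n} → k < n → (xs : Fin k → Fin n) → Σ (Fin n) λ y → ∀ i → xs i ≢ y
outside {k} {n} k<n xs with FinP.any? (λ y → ¬? (FinP.any? (λ i → xs i FinP.≟ y)))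
... | yes (y , uncovered) = y , λ i xsi≡y → uncovered (i , xsi≡y)
... | no all-covered = ⊥-elim (pigeon (FinP.pigeonhole k<n (proj₁ ∘ preimage)))
  where
  preimage : ∀ y → Σ (Fin k) λ i → xs i ≡ y
  preimage y with FinP.any? (λ i → xs i FinP.≟ y)
  ... | yes hit = hit
  ... | no uncovered = ⊥-elim (all-covered (y , uncovered))
  pigeon : (Σ (Fin n) λ y → Σ (Fin n) λ y′ → y Fin.< y′ × proj₁ (preimage y) ≡ proj₁ (preimage y′)) → ⊥
  pigeon (y , y′ , y<y′ , same) = FinP.<-irrefl
    (trans (sym (proj₂ (preimage y))) (trans (cong xs same) (proj₂ (preimage y′)))) y<y′

-- A property of 4-tuples that is invariant under the adjacent transpositions
-- holds for every tuple of distinct vertices once it holds for increasing ones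
-- (sort the tuple by insertion).
module SortFour {n : ℕ} (P : Fin n → Fin n → Fin n → Fin n → Set)
  (swap₁₂ : ∀ {a b c d} → P a b c d → P b a c d)
  (swap₂₃ : ∀ {a b c d} → P a b c d → P a c b d)
  (swap₃₄ : ∀ {a b c d} → P a b c d → P a b d c)
  (increasing : ∀ {a b c d} → a Fin.< b → b Fin.< c → c Fin.< d → P a b c d) where

  private
    insert₄ : ∀ {a b c d} → a Fin.< b → b Fin.< c → d ≢ a → d ≢ b → d ≢ c → P a b c d
    insert₄ {a} {b} {c} {d} a<b b<c d≢a d≢b d≢c with FinP.<-cmp c d
    ... | tri< c<d _ _ = increasing a<b b<c c<d
    ... | tri≈ _ c≡d _ = ⊥-elim (d≢c (sym c≡d))
    ... | tri> _ _ d<c with FinP.<-cmp b d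
    ...   | tri< b<d _ _ = swap₃₄ (increasing a<b b<d d<c)
    ...   | tri≈ _ b≡d _ = ⊥-elim (d≢b (sym b≡d))
    ...   | tri> _ _ d<b with FinP.<-cmp a d
    ...     | tri< a<d _ _ = swap₃₄ (swap₂₃ (increasing a<d d<b b<c))
    ...     | tri≈ _ a≡d _ = ⊥-elim (d≢a (sym a≡d))
    ...     | tri> _ _ d<a = swap₃₄ (swap₂₃ (swap₁₂ (increasing d<a a<b b<c)))

    insert₃ : ∀ {a b c d} → a Fin.< b → c ≢ a → c ≢ b → d ≢ a → d ≢ b → d ≢ c → P a b c d
    insert₃ {a} {b} {c} {d} a<b c≢a c≢b d≢a d≢b d≢c with FinP.<-cmp b c
    ... | tri< b<c _ _ = insert₄ a<b b<c d≢a d≢b d≢c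
    ... | tri≈ _ b≡c _ = ⊥-elim (c≢b (sym b≡c))
    ... | tri> _ _ c<b with FinP.<-cmp a c
    ...   | tri< a<c _ _ = swap₂₃ (insert₄ a<c c<b d≢a d≢c d≢b)
    ...   | tri≈ _ a≡c _ = ⊥-elim (c≢a (sym a≡c))
    ...   | tri> _ _ c<a = swap₂₃ (swap₁₂ (insert₄ c<a a<b d≢c d≢a d≢b))

  sortFour : ∀ {a b c d} → a ≢ b → a ≢ c → a ≢ d → b ≢ c → b ≢ d → c ≢ d → P a b c d
  sortFour {a} {b} {c} {d} a≢b a≢c a≢d b≢c b≢d c≢d with FinP.<-cmp a b
  ... | tri< a<b _ _ = insert₃ a<b (≢-sym a≢c) (≢-sym b≢c) (≢-sym a≢d) (≢-sym b≢d) (≢-sym c≢d)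
  ... | tri≈ _ a≡b _ = ⊥-elim (a≢b a≡b)
  ... | tri> _ _ b<a = swap₁₂ (insert₃ b<a (≢-sym b≢c) (≢-sym a≢c) (≢-sym b≢d) (≢-sym a≢d) (≢-sym c≢d))

-- A simple graph on the vertex set Fin n, given by a symmetric irreflexive
-- boolean adjacency matrix.
record SimpleGraph (n : ℕ) : Set where
  field
    adj : Fin n → Fin n → Bool
    adj-sym : ∀ u v → adj u v ≡ adj v u
    adj-irrefl : ∀ u → adj u u ≡ false

module SimpleGraphProps {n : ℕ} (G : SimpleGraph n) where
  open SimpleGraph G public

  infix 4 _~_
  _~_ : Fin n → Fin n → Set
  u ~ v = adj u v ≡ true

  ~-sym : ∀ {u v} → u ~ v → v ~ u
  ~-sym {u} {v} u~v = trans (adj-sym v u) u~v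

  ~⇒≢ : ∀ {u v} → u ~ v → u ≢ v
  ~⇒≢ {u} u~u refl with () ← trans (sym u~u) (adj-irrefl u)

  -- a non-edge, read off from a proof that the edge would be impossible
  ≁⇒false : ∀ {u v} → ¬ (u ~ v) → adj u v ≡ false
  ≁⇒false {u} {v} u≁v with adj u v
  ... | true = ⊥-elim (u≁v refl)
  ... | false = refl

  deg : Fin n → ℕ
  deg v = sum (χ ∘ adj v)

  -- Distinct neighbours bound the degree from below ...
  deg-≥₁ : ∀ {v x} → v ~ x → 1 ≤ deg v
  deg-≥₁ {v} {x} v~x = subst (_≤ deg v) (cong χ v~x) (sum-≥₁ (χ ∘ adj v) x)

  deg-≥₂ : ∀ {v x y} → v ~ x → v ~ y → y ≢ x → 2 ≤ deg v
  deg-≥₂ {v} v~x v~y y≢x = subst (_≤ deg v) (cong₂ _+_ (cong χ v~x) (cong χ v~y)) (sum-≥₂ (χ ∘ adj v) y≢x)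

  deg-≥₃ : ∀ {v x y z} → v ~ x → v ~ y → v ~ z → y ≢ x → z ≢ x → z ≢ y → 3 ≤ deg v
  deg-≥₃ {v} v~x v~y v~z y≢x z≢x z≢y =
    subst (_≤ deg v) (cong₂ _+_ (cong₂ _+_ (cong χ v~x) (cong χ v~y)) (cong χ v~z))
      (sum-≥₃ (χ ∘ adj v) y≢x z≢x z≢y)

  -- ... and, conversely, a degree bound provides neighbours.
  some-neighbour : ∀ {v} → 1 ≤ deg v → Σ (Fin n) λ x → v ~ x
  some-neighbour {v} 1≤deg with nonzero-summand (χ ∘ adj v) (λ deg≡0 → ℕP.<-irrefl (sym deg≡0) 1≤deg)
  ... | x , nz = x , χ≢0⇒true nz

  other-neighbour : ∀ {v x} → 2 ≤ deg v → v ~ x → Σ (Fin n) λ y → y ≢ x × v ~ y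
  other-neighbour {v} {x} 2≤deg v~x with second-summand (χ ∘ adj v) (χ≤1 (adj v x)) 2≤deg
  ... | y , y≢x , nz = y , y≢x , χ≢0⇒true nz

  third-neighbour : ∀ {v x y} → 3 ≤ deg v → v ~ x → v ~ y → y ≢ x →
                    Σ (Fin n) λ z → z ≢ x × z ≢ y × v ~ z
  third-neighbour {v} {x} {y} 3≤deg v~x v~y y≢x
    with third-summand (χ ∘ adj v) (χ≤1 (adj v x)) (χ≤1 (adj v y)) y≢x 3≤deg
  ... | z , z≢x , z≢y , nz = z , z≢x , z≢y , χ≢0⇒true nz

  -- The number of edges spanned by four vertices; it does not depend on their order.
  edges4 : Fin n → Fin n → Fin n → Fin n → ℕ
  edges4 a b c d = χ (adj a b) + χ (adj a c) + χ (adj a d) + χ (adj b c) + χ (adj b d) + χ (adj c d)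

  edges4-swap₁₂ : ∀ a b c d → edges4 a b c d ≡ edges4 b a c d
  edges4-swap₁₂ a b c d rewrite adj-sym a b =
    solve 6 (λ ab ac ad bc bd cd → ab :+ ac :+ ad :+ bc :+ bd :+ cd := ab :+ bc :+ bd :+ ac :+ ad :+ cd) refl
      (χ (adj b a)) (χ (adj a c)) (χ (adj a d)) (χ (adj b c)) (χ (adj b d)) (χ (adj c d))

  edges4-swap₂₃ : ∀ a b c d → edges4 a b c d ≡ edges4 a c b d
  edges4-swap₂₃ a b c d rewrite adj-sym b c =
    solve 6 (λ ab ac ad bc bd cd → ab :+ ac :+ ad :+ bc :+ bd :+ cd := ac :+ ab :+ ad :+ bc :+ cd :+ bd) refl
      (χ (adj a b)) (χ (adj a c)) (χ (adj a d)) (χ (adj c b)) (χ (adj b d)) (χ (adj c d))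

  edges4-swap₃₄ : ∀ a b c d → edges4 a b c d ≡ edges4 a b d c
  edges4-swap₃₄ a b c d rewrite adj-sym c d =
    solve 6 (λ ab ac ad bc bd cd → ab :+ ac :+ ad :+ bc :+ bd :+ cd := ab :+ ad :+ ac :+ bd :+ bc :+ cd) refl
      (χ (adj a b)) (χ (adj a c)) (χ (adj a d)) (χ (adj b c)) (χ (adj b d)) (χ (adj d c))

  -- The central hypothesis: no four distinct vertices span exactly three edges.
  NoThreeEdges : Set
  NoThreeEdges = ∀ {a b c d} → a ≢ b → a ≢ c → a ≢ d → b ≢ c → b ≢ d → c ≢ d → edges4 a b c d ≢ 3

  -- It suffices to check increasing quadruples.
  noThreeEdges-increasing : (∀ {a b c d} → a Fin.< b → b Fin.< c → c Fin.< d → edges4 a b c d ≢ 3) →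
                            NoThreeEdges
  noThreeEdges-increasing = SortFour.sortFour (λ a b c d → edges4 a b c d ≢ 3)
    (λ {a} {b} {c} {d} ≢3 → ≢3 ∘ trans (edges4-swap₁₂ a b c d))
    (λ {a} {b} {c} {d} ≢3 → ≢3 ∘ trans (edges4-swap₂₃ a b c d))
    (λ {a} {b} {c} {d} ≢3 → ≢3 ∘ trans (edges4-swap₃₄ a b c d))

-- Local structure of a graph on n ≥ 5 vertices with at most n edges in which
-- no four vertices span exactly three edges: it is triangle-free, every degree
-- is at most 2, and every path of length 2 between degree-2 vertices closes
-- into a 4-cycle.
module LocalStructure {n : ℕ} (G : SimpleGraph n) (5≤n : 5 ≤ n)
  (noThree : SimpleGraphProps.NoThreeEdges G)
  (sparse : sum (SimpleGraphProps.deg G) ≤ n * 2) where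
  open SimpleGraphProps G

  -- The hypothesis, applied to the six adjacency values of four distinct vertices.
  forbidden : ∀ {a b c d x₁ x₂ x₃ x₄ x₅ x₆} → a ≢ b → a ≢ c → a ≢ d → b ≢ c → b ≢ d → c ≢ d →
              adj a b ≡ x₁ → adj a c ≡ x₂ → adj a d ≡ x₃ → adj b c ≡ x₄ → adj b d ≡ x₅ → adj c d ≡ x₆ →
              χ x₁ + χ x₂ + χ x₃ + χ x₄ + χ x₅ + χ x₆ ≡ 3 → ⊥
  forbidden a≢b a≢c a≢d b≢c b≢d c≢d refl refl refl refl refl refl = noThree a≢b a≢c a≢d b≢c b≢d c≢d

  -- A vertex outside a triangle is adjacent to one of its corners, since
  -- otherwise the four vertices span exactly the three triangle edges.
  triangle-dominates : ∀ {a b c} → a ~ b → b ~ c → a ~ c → ∀ {x} → x ≢ a → x ≢ b → x ≢ c →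
                       x ~ a ⊎ x ~ b ⊎ x ~ c
  triangle-dominates {a} {b} {c} a~b b~c a~c {x} x≢a x≢b x≢c with adj x a in xa | adj x b in xb | adj x c in xc
  ... | true | _ | _ = inj₁ refl
  ... | false | true | _ = inj₂ (inj₁ refl)
  ... | false | false | true = inj₂ (inj₂ refl)
  ... | false | false | false = ⊥-elim (forbidden x≢a x≢b x≢c (~⇒≢ a~b) (~⇒≢ a~c) (~⇒≢ b~c) xa xb xc a~b a~c b~c refl)

  -- If a triangle exists, no vertex outside it is a leaf attached to it: take a
  -- fifth vertex y; whichever corners y sees, four of the vertices span
  -- exactly three edges.
  no-leaf-at-triangle : ∀ {a b c} → a ~ b → b ~ c → a ~ c → ∀ {x} → x ≢ a → x ≢ b → x ≢ c →
                        x ~ a → ¬ (2 ≤ deg x) → ⊥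
  no-leaf-at-triangle {a} {b} {c} a~b b~c a~c {x} x≢a x≢b x≢c x~a deg<2
    with outside 5≤n (a ∷ b ∷ c ∷ x ∷ [])
  ... | y , fresh = sees (adj y a) refl (adj y b) refl (adj y c) refl
    where
    y≢a : y ≢ a
    y≢a = ≢-sym (fresh fz)
    y≢b : y ≢ b
    y≢b = ≢-sym (fresh (fs fz))
    y≢c : y ≢ c
    y≢c = ≢-sym (fresh (fs (fs fz)))
    x≢y : x ≢ y
    x≢y = fresh (fs (fs (fs fz)))
    only-a : ∀ {w} → w ≢ a → adj x w ≡ false
    only-a w≢a = ≁⇒false (λ x~w → deg<2 (deg-≥₂ x~a x~w w≢a))
    sees : ∀ p → adj y a ≡ p → ∀ q → adj y b ≡ q → ∀ r → adj y c ≡ r → ⊥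
    sees true ya true yb true yc =
      forbidden x≢y x≢b x≢c y≢b y≢c (~⇒≢ b~c) (only-a y≢a) (only-a (≢-sym (~⇒≢ a~b))) (only-a (≢-sym (~⇒≢ a~c))) yb yc b~c refl
    sees true ya true yb false yc =
      forbidden x≢y x≢a x≢c y≢a y≢c (~⇒≢ a~c) (only-a y≢a) x~a (only-a (≢-sym (~⇒≢ a~c))) ya yc a~c refl
    sees true ya false yb _ _ =
      forbidden x≢y x≢a x≢b y≢a y≢b (~⇒≢ a~b) (only-a y≢a) x~a (only-a (≢-sym (~⇒≢ a~b))) ya yb a~b refl
    sees false ya true yb _ _ =
      forbidden x≢y x≢a x≢b y≢a y≢b (~⇒≢ a~b) (only-a y≢a) x~a (only-a (≢-sym (~⇒≢ a~b))) ya yb a~b refl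
    sees false ya false yb true yc =
      forbidden x≢y x≢a x≢c y≢a y≢c (~⇒≢ a~c) (only-a y≢a) x~a (only-a (≢-sym (~⇒≢ a~c))) ya yc a~c refl
    sees false ya false yb false yc with triangle-dominates a~b b~c a~c y≢a y≢b y≢c
    ... | inj₁ y~a = false≢true (trans (sym ya) y~a)
    ... | inj₂ (inj₁ y~b) = false≢true (trans (sym yb) y~b)
    ... | inj₂ (inj₂ y~c) = false≢true (trans (sym yc) y~c)

  -- Hence, in the presence of a triangle, every vertex has degree at least 2 ...
  triangle⇒deg≥2 : ∀ {a b c} → a ~ b → b ~ c → a ~ c → ∀ x → 2 ≤ deg x
  triangle⇒deg≥2 {a} {b} {c} a~b b~c a~c x with x FinP.≟ a | x FinP.≟ b | x FinP.≟ c
  ... | yes refl | _ | _ = deg-≥₂ a~b a~c (≢-sym (~⇒≢ b~c))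
  ... | no _ | yes refl | _ = deg-≥₂ (~-sym a~b) b~c (≢-sym (~⇒≢ a~c))
  ... | no _ | no _ | yes refl = deg-≥₂ (~-sym a~c) (~-sym b~c) (≢-sym (~⇒≢ a~b))
  ... | no x≢a | no x≢b | no x≢c with 2 ℕP.≤? deg x
  ...   | yes 2≤deg = 2≤deg
  ...   | no deg<2 with triangle-dominates a~b b~c a~c x≢a x≢b x≢c
  ...     | inj₁ x~a = ⊥-elim (no-leaf-at-triangle a~b b~c a~c x≢a x≢b x≢c x~a deg<2)
  ...     | inj₂ (inj₁ x~b) = ⊥-elim (no-leaf-at-triangle (~-sym a~b) a~c b~c x≢b x≢a x≢c x~b deg<2)
  ...     | inj₂ (inj₂ x~c) = ⊥-elim (no-leaf-at-triangle (~-sym a~c) a~b (~-sym b~c) x≢c x≢a x≢b x~c deg<2)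

  -- With all degrees at least 2, a single vertex of degree 3 already pushes
  -- the degree sum above 2n.
  triangle⇒deg<3 : ∀ {a b c} → a ~ b → b ~ c → a ~ c → ∀ t → ¬ (3 ≤ deg t)
  triangle⇒deg<3 a~b b~c a~c t 3≤deg = ℕP.<-irrefl refl (ℕP.≤-trans big sparse)
    where
    excess : Fin n → ℕ
    excess i = deg i ∸ 2
    big : suc (n * 2) ≤ sum deg
    big = begin
      suc (n * 2)                      ≡⟨ ℕP.+-comm 1 (n * 2) ⟩
      n * 2 + 1                        ≤⟨ ℕP.+-monoʳ-≤ (n * 2) (ℕP.≤-trans (ℕP.∸-monoˡ-≤ 2 3≤deg) (sum-≥₁ excess t)) ⟩
      n * 2 + sum excess               ≡⟨ cong (_+ sum excess) (sym (sum-const n 2)) ⟩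
      sum {n} (λ _ → 2) + sum excess   ≡⟨ sym (∑-distrib-+ (λ _ → 2) excess) ⟩
      sum (λ i → 2 + excess i)         ≡⟨ sum-cong-≗ (λ i → ℕP.m+[n∸m]≡n (triangle⇒deg≥2 a~b b~c a~c i)) ⟩
      sum deg                          ∎
      where open ℕP.≤-Reasoning

  -- But some corner does have a third neighbour, as any vertex off the
  -- triangle sees a corner: there is no triangle.
  triangle-free : ∀ {a b c} → a ~ b → b ~ c → a ~ c → ⊥
  triangle-free {a} {b} {c} a~b b~c a~c with outside (ℕP.≤-trans (s≤s (s≤s (s≤s (s≤s z≤n)))) 5≤n) (a ∷ b ∷ c ∷ [])
  ... | y , fresh with triangle-dominates a~b b~c a~c (≢-sym (fresh fz)) (≢-sym (fresh (fs fz))) (≢-sym (fresh (fs (fs fz))))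
  ...   | inj₁ y~a = triangle⇒deg<3 a~b b~c a~c a
          (deg-≥₃ a~b a~c (~-sym y~a) (≢-sym (~⇒≢ b~c)) (≢-sym (fresh (fs fz))) (≢-sym (fresh (fs (fs fz)))))
  ...   | inj₂ (inj₁ y~b) = triangle⇒deg<3 a~b b~c a~c b
          (deg-≥₃ (~-sym a~b) b~c (~-sym y~b) (≢-sym (~⇒≢ a~c)) (≢-sym (fresh fz)) (≢-sym (fresh (fs (fs fz)))))
  ...   | inj₂ (inj₂ y~c) = triangle⇒deg<3 a~b b~c a~c c
          (deg-≥₃ (~-sym a~c) (~-sym b~c) (~-sym y~c) (≢-sym (~⇒≢ a~b)) (≢-sym (fresh fz)) (≢-sym (fresh (fs fz))))

  -- No vertex has three neighbours: they would be pairwise non-adjacent, so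
  -- the vertex and its neighbours span exactly three edges.
  deg≤2 : ∀ v → deg v ≤ 2
  deg≤2 v with 3 ℕP.≤? deg v
  ... | no deg<3 = ℕP.≤-pred (ℕP.≰⇒> deg<3)
  ... | yes 3≤deg with some-neighbour (ℕP.≤-trans (s≤s z≤n) 3≤deg)
  ...   | x , v~x with other-neighbour (ℕP.≤-trans (s≤s (s≤s z≤n)) 3≤deg) v~x
  ...     | y , y≢x , v~y with third-neighbour 3≤deg v~x v~y y≢x
  ...       | z , z≢x , z≢y , v~z = ⊥-elim
    (forbidden (~⇒≢ v~x) (~⇒≢ v~y) (~⇒≢ v~z) (≢-sym y≢x) (≢-sym z≢x) (≢-sym z≢y)
      v~x v~y v~z (no-edge v~x v~y) (no-edge v~x v~z) (no-edge v~y v~z) refl)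
    where
    no-edge : ∀ {p q} → v ~ p → v ~ q → adj p q ≡ false
    no-edge v~p v~q = ≁⇒false (λ p~q → triangle-free v~p p~q v~q)

  -- Consequently a vertex has no neighbours besides two known distinct ones,
  -- nor besides a single known one when its degree is at most 1.
  neighbours≤2 : ∀ {v x y z} → v ~ x → v ~ y → y ≢ x → v ~ z → z ≡ x ⊎ z ≡ y
  neighbours≤2 {v} {x} {y} {z} v~x v~y y≢x v~z with z FinP.≟ x | z FinP.≟ y
  ... | yes z≡x | _ = inj₁ z≡x
  ... | no _ | yes z≡y = inj₂ z≡y
  ... | no z≢x | no z≢y = ⊥-elim (ℕP.<-irrefl refl (ℕP.≤-trans (deg-≥₃ v~x v~y v~z y≢x z≢x z≢y) (deg≤2 v)))

  neighbour≤1 : ∀ {v x z} → deg v ≤ 1 → v ~ x → v ~ z → z ≡ x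
  neighbour≤1 {v} {x} {z} deg≤1 v~x v~z with z FinP.≟ x
  ... | yes z≡x = z≡x
  ... | no z≢x = ⊥-elim (ℕP.<-irrefl refl (ℕP.≤-trans (deg-≥₂ v~x v~z z≢x) deg≤1))

  -- Two neighbours of a vertex are not adjacent (no triangles).
  common-neighbour⇒non-adjacent : ∀ {v x y} → v ~ x → v ~ y → adj x y ≡ false
  common-neighbour⇒non-adjacent v~x v~y = ≁⇒false (λ x~y → triangle-free v~x x~y v~y)

  -- Squares close: if v has neighbours x ≠ y and x has a neighbour w ≠ v, then
  -- w is adjacent to y, for otherwise w, x, v, y span exactly three edges.
  module Square {v x y w} (v~x : v ~ x) (v~y : v ~ y) (y≢x : y ≢ x) (x~w : x ~ w) (w≢v : w ≢ v) where
    w≢y : w ≢ y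
    w≢y refl with () ← trans (sym x~w) (common-neighbour⇒non-adjacent v~x v~y)

    w≁v : adj w v ≡ false
    w≁v = ≁⇒false (λ w~v → ℕP.<-irrefl refl (ℕP.≤-trans
      (deg-≥₃ v~x v~y (~-sym w~v) y≢x (≢-sym (~⇒≢ x~w)) w≢y) (deg≤2 v)))

    w~y : w ~ y
    w~y with adj w y in wy
    ... | true = refl
    ... | false = ⊥-elim (forbidden (≢-sym (~⇒≢ x~w)) w≢v w≢y (≢-sym (~⇒≢ v~x)) (≢-sym y≢x) (~⇒≢ v~y)
                            (~-sym x~w) w≁v wy (~-sym v~x) (common-neighbour⇒non-adjacent v~x v~y) v~y refl)

  -- A path z – c – y – w′ cannot start at a vertex z of degree at most 1:
  -- the four vertices would span exactly the three path edges.
  leaf-path : ∀ {z c y w′} → deg z ≤ 1 → z ~ c → c ~ y → y ≢ z → y ~ w′ → w′ ≢ c → ⊥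
  leaf-path {z} {c} {y} {w′} z≤1 z~c c~y y≢z y~w′ w′≢c =
    forbidden (~⇒≢ z~c) (≢-sym y≢z) z≢w′ (~⇒≢ c~y) (≢-sym w′≢c) (~⇒≢ y~w′)
      z~c (only-c (≢-sym (~⇒≢ c~y))) (only-c w′≢c) c~y c≁w′ y~w′ refl
    where
    only-c : ∀ {u} → u ≢ c → adj z u ≡ false
    only-c u≢c = ≁⇒false (λ z~u → u≢c (neighbour≤1 z≤1 z~c z~u))
    z≢w′ : z ≢ w′
    z≢w′ refl with () ← trans (sym (~-sym y~w′)) (only-c (≢-sym (~⇒≢ c~y)))
    c≁w′ : adj c w′ ≡ false
    c≁w′ = ≁⇒false λ c~w′ → [ z≢w′ ∘ sym , ~⇒≢ y~w′ ∘ sym ]′ (neighbours≤2 (~-sym z~c) c~y y≢z c~w′)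

-- Decision procedures, used for finite checks by evaluation. A decision
-- procedure exhibits its proposition as a boolean equation.
does⇔ : ∀ {A : Set} (a? : Dec A) → A ⇔ (does a? ≡ true)
does⇔ a? = mk⇔ (dec-true a?) (from-does a?)
  where
  from-does : ∀ {A : Set} (a? : Dec A) → does a? ≡ true → A
  from-does (yes a) _ = a
  from-does (no _) ()

all-Sign? : ∀ {P : Sign → Set} → (∀ s → Dec (P s)) → Dec (∀ s → P s)
all-Sign? P? = Dec.map′ (λ (p₊ , p₋) → λ { Sign.+ → p₊ ; Sign.- → p₋ }) (λ p → p Sign.+ , p Sign.-)
                        (P? Sign.+ ×-dec P? Sign.-)

_⇔?_ : ∀ {A B : Set} → Dec A → Dec B → Dec (A ⇔ B)
a? ⇔? b? = Dec.map′ (λ (to , from) → mk⇔ to from) (λ A⇔B → Equivalence.to A⇔B , Equivalence.from A⇔B)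
                    ((a? →-dec b?) ×-dec (b? →-dec a?))

all-Bool? : ∀ {P : Bool → Set} → (∀ b → Dec (P b)) → Dec (∀ b → P b)
all-Bool? P? = Dec.map′ (λ (p₁ , p₀) → λ { true → p₁ ; false → p₀ }) (λ p → p true , p false)
                        (P? true ×-dec P? false)

-- Adjacency in the small graphs of the statement is decidable.
C₄-adj? : ∀ i j → Dec (Adj C₄ i j)
C₄-adj? i j = (suc (toℕ i) % 4 ℕ.≟ toℕ j) ⊎-dec (suc (toℕ j) % 4 ℕ.≟ toℕ i)

K₂-adj? : ∀ i j → Dec (Adj K₂ i j)
K₂-adj? i j = ¬? (i FinP.≟ j)

P₂-adj? : ∀ i j → Dec (Adj P₂ i j)
P₂-adj? i j = (suc (toℕ i) ℕ.≟ toℕ j) ⊎-dec (suc (toℕ j) ℕ.≟ toℕ i)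

-- Graph isomorphisms compose, and are compatible with disjoint union.
≅-trans : ∀ {G H K : Graph} → G ≅ H → H ≅ K → G ≅ K
≅-trans (φ , φ-adj) (ψ , ψ-adj) =
  ↔-trans φ ψ , λ u v → ψ-adj (Inverse.to φ u) (Inverse.to φ v) ⇔-∘ φ-adj u v

⊕-congˡ : ∀ {G H : Graph} (K : Graph) → G ≅ H → (K ⊕ G) ≅ (K ⊕ H)
⊕-congˡ {G} {H} K (φ , φ-adj) = (↔-refl ⊎-↔ φ) , adj-pres
  where
  adj-pres : ∀ u v → Adj (K ⊕ G) u v ⇔ Adj (K ⊕ H) (Inverse.to (↔-refl ⊎-↔ φ) u) (Inverse.to (↔-refl ⊎-↔ φ) v)
  adj-pres (inj₁ u) (inj₁ v) = ⇔-id _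
  adj-pres (inj₁ u) (inj₂ v) = ⇔-id _
  adj-pres (inj₂ u) (inj₁ v) = ⇔-id _
  adj-pres (inj₂ u) (inj₂ v) = φ-adj u v

-- Vertex subsets of Fin n are boolean predicates; membership proofs are unique.
bool-irrelevant : ∀ {a b : Bool} (p q : a ≡ b) → p ≡ q
bool-irrelevant = Decidable⇒UIP.≡-irrelevant BoolP._≟_

-- Peeling components off a graph: a piece is a copy of a graph K in G that is
-- a union of connected components, and removing it from a subset S of the
-- vertices splits the induced subgraph as K ⊕ (the rest).
module Pieces {n : ℕ} (G : SimpleGraph n) where
  open SimpleGraphProps G

  -- The subgraph induced on a subset, and subsets closed under adjacency.
  induced : (Fin n → Bool) → Graph
  induced S = record { Vertex = Σ (Fin n) (λ v → S v ≡ true) ; Adj = λ u v → proj₁ u ~ proj₁ v }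

  Closed : (Fin n → Bool) → Set
  Closed S = ∀ {u w} → S u ≡ true → u ~ w → S w ≡ true

  everything : Fin n → Bool
  everything _ = true

  -- A decomposition of G as J ⊕ q·C₄.
  Decomposition : Graph → Set
  Decomposition J = Σ ℕ λ q → induced everything ≅ (J ⊕ copies q C₄)

  -- A piece: an induced copy ι of K, with decidable image, that is closed
  -- under adjacency (so a union of components of G).
  record Piece (K : Graph) : Set where
    field
      ι : Vertex K → Fin n
      ι-injective : ∀ {s t} → ι s ≡ ι t → s ≡ t
      image? : ∀ v → Dec (Σ (Vertex K) λ s → ι s ≡ v)
      ι-adj : ∀ s t → Adj K s t ⇔ (ι s ~ ι t)
      closed : ∀ s {v} → ι s ~ v → Σ (Vertex K) λ t → ι t ≡ v

  -- For pieces on Fin k the image is decidable, and adjacency can be checked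
  -- against a table given by a decision procedure for the adjacency of K.
  fin-image? : ∀ {k} (ι : Fin k → Fin n) v → Dec (Σ (Fin k) λ s → ι s ≡ v)
  fin-image? ι v = FinP.any? (λ s → ι s FinP.≟ v)

  adj-from-table : ∀ {K : Graph} (adj? : ∀ s t → Dec (Adj K s t)) {ι : Vertex K → Fin n} →
                   (∀ s t → adj (ι s) (ι t) ≡ does (adj? s t)) → ∀ s t → Adj K s t ⇔ (ι s ~ ι t)
  adj-from-table {K} adj? table s t = subst (λ b → Adj K s t ⇔ (b ≡ true)) (sym (table s t)) (does⇔ (adj? s t))

  module Peel {K : Graph} (P : Piece K) where
    open Piece P

    -- S with the vertices of the piece removed
    _∖P : (Fin n → Bool) → Fin n → Bool
    (S ∖P) v with image? v
    ... | yes _ = false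
    ... | no _ = S v

    -- S ∖P lies in S, keeps the vertices off the piece, and drops the piece.
    ∖P-⊆ : ∀ S v → (S ∖P) v ≡ true → S v ≡ true
    ∖P-⊆ S v v∈S′ with image? v
    ... | no _ = v∈S′

    ∖P-keep : ∀ S v → ¬ (Σ (Vertex K) λ s → ι s ≡ v) → S v ≡ true → (S ∖P) v ≡ true
    ∖P-keep S v ∉ v∈S with image? v
    ... | yes hit = ⊥-elim (∉ hit)
    ... | no _ = v∈S

    ∖P-ι : ∀ S s → (S ∖P) (ι s) ≡ false
    ∖P-ι S s with image? (ι s)
    ... | yes _ = refl
    ... | no ∉ = ⊥-elim (∉ (s , refl))

    -- Removing a union of components keeps a set closed under adjacency.
    ∖P-closed : ∀ {S} → Closed S → Closed (S ∖P)
    ∖P-closed {S} S-closed {u} {w} u∈S′ u~w with image? w | image? u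
    ... | yes (t , refl) | no u∉ = ⊥-elim (u∉ (closed t (~-sym u~w)))
    ... | no _ | no _ = S-closed u∈S′ u~w

    -- The splitting isomorphism, for any S containing the piece.
    peel : ∀ {S} → (∀ s → S (ι s) ≡ true) → induced S ≅ (K ⊕ induced (S ∖P))
    peel {S} ι∈S = mk↔ₛ′ to from to∘from from∘to , adj-pres
      where
      -- a vertex of S goes to K if it lies in the piece, and stays otherwise
      route : ∀ v → S v ≡ true → Dec (Σ (Vertex K) λ s → ι s ≡ v) → Vertex (K ⊕ induced (S ∖P))
      route v v∈S (yes (s , _)) = inj₁ s
      route v v∈S (no ∉) = inj₂ (v , ∖P-keep S v ∉ v∈S)

      to : Vertex (induced S) → Vertex (K ⊕ induced (S ∖P))
      to (v , v∈S) = route v v∈S (image? v)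

      from : Vertex (K ⊕ induced (S ∖P)) → Vertex (induced S)
      from (inj₁ s) = ι s , ι∈S s
      from (inj₂ (v , v∈S′)) = v , ∖P-⊆ S v v∈S′

      to∘from : ∀ x → to (from x) ≡ x
      to∘from (inj₁ s) with image? (ι s)
      ... | yes (t , ιt≡ιs) = cong inj₁ (ι-injective ιt≡ιs)
      ... | no ∉ = ⊥-elim (∉ (s , refl))
      to∘from (inj₂ (v , v∈S′)) = stays (image? v)
        where
        stays : ∀ d → route v (∖P-⊆ S v v∈S′) d ≡ inj₂ (v , v∈S′)
        stays (yes (s , refl)) = ⊥-elim (false≢true (trans (sym (∖P-ι S s)) v∈S′))
        stays (no _) = cong (λ p → inj₂ (v , p)) (bool-irrelevant _ _)

      from∘to : ∀ x → from (to x) ≡ x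
      from∘to (v , v∈S) with image? v
      ... | yes (s , refl) = cong (ι s ,_) (bool-irrelevant _ _)
      ... | no _ = cong (v ,_) (bool-irrelevant _ _)

      adj-pres : ∀ u v → Adj (induced S) u v ⇔ Adj (K ⊕ induced (S ∖P)) (to u) (to v)
      adj-pres (u , _) (v , _) with image? u | image? v
      ... | yes (s , refl) | yes (t , refl) = ⇔-sym (ι-adj s t)
      ... | yes (s , refl) | no v∉ = mk⇔ (λ u~v → v∉ (closed s u~v)) λ ()
      ... | no u∉ | yes (t , refl) = mk⇔ (λ u~v → u∉ (closed t (~-sym u~v))) λ ()
      ... | no _ | no _ = ⇔-id _

    -- Removing a non-empty piece makes the subset strictly smaller.
    size-∖P : ∀ {S} → (∀ s → S (ι s) ≡ true) → Vertex K → sum (χ ∘ (S ∖P)) < sum (χ ∘ S)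
    size-∖P {S} ι∈S s = sum-strict (λ v → χ-mono (∖P-⊆ S v)) (ι s)
      (subst₂ (λ a b → χ a < χ b) (sym (∖P-ι S s)) (sym (ι∈S s)) (s≤s z≤n))

  -- A piece isomorphic to C₄ lies entirely inside any closed set meeting it.
  C₄-inside : ∀ {S} → Closed S → (P : Piece C₄) → S (Piece.ι P fz) ≡ true → ∀ s → S (Piece.ι P s) ≡ true
  C₄-inside {S} S-closed P ι₀∈S = inside
    where
    open Piece P
    step : ∀ s t → Adj C₄ s t → S (ι s) ≡ true → S (ι t) ≡ true
    step s t s-t ιs∈S = S-closed ιs∈S (Equivalence.to (ι-adj s t) s-t)
    ι₁∈S : S (ι (fs fz)) ≡ true
    ι₁∈S = step fz (fs fz) (inj₁ refl) ι₀∈S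
    ι₂∈S : S (ι (fs (fs fz))) ≡ true
    ι₂∈S = step (fs fz) (fs (fs fz)) (inj₁ refl) ι₁∈S
    ι₃∈S : S (ι (fs (fs (fs fz)))) ≡ true
    ι₃∈S = step (fs (fs fz)) (fs (fs (fs fz))) (inj₁ refl) ι₂∈S
    inside : ∀ s → S (ι s) ≡ true
    inside fz = ι₀∈S
    inside (fs fz) = ι₁∈S
    inside (fs (fs fz)) = ι₂∈S
    inside (fs (fs (fs fz))) = ι₃∈S

  -- A subset of size 0 induces the empty graph.
  induced-empty : ∀ {S} → sum (χ ∘ S) ≡ 0 → induced S ≅ emptyGraph
  induced-empty {S} size≡0 = mk↔ₛ′ (λ { (v , v∈S) → absurd v v∈S }) (λ ()) (λ ()) (λ { (v , v∈S) → absurd v v∈S })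
                           , λ { (v , v∈S) → absurd v v∈S }
    where
    absurd : ∀ {A : Set} v → S v ≡ true → A
    absurd v v∈S with () ← trans (sym (cong χ v∈S)) (zero-sum⇒zero (χ ∘ S) size≡0 v)

  -- Every vertex of S lies on a square that is a whole component.
  Squares : (Fin n → Bool) → Set
  Squares S = ∀ {v} → S v ≡ true → Σ (Piece C₄) λ P → Piece.ι P fz ≡ v

  -- Then the subgraph induced on a closed set S is a disjoint union of copies
  -- of C₄: peel one square after another (by induction on the size of S).
  decompose : ∀ {S} → Closed S → Squares S → Σ ℕ λ q → induced S ≅ copies q C₄
  decompose {S} = go (suc (sum (χ ∘ S))) S ℕP.≤-refl
    where
    go : ∀ bound S → sum (χ ∘ S) < bound → Closed S → Squares S → Σ ℕ λ q → induced S ≅ copies q C₄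
    go (suc bound) S size<bound S-closed squares with sum (χ ∘ S) ℕ.≟ 0
    ... | yes size≡0 = 0 , induced-empty size≡0
    ... | no size≢0 with nonzero-summand (χ ∘ S) size≢0
    ...   | v , χ≢0 = peel-square (χ≢0⇒true χ≢0) (squares (χ≢0⇒true χ≢0))
      where
      peel-square : ∀ {v} → S v ≡ true → Σ (Piece C₄) (λ P → Piece.ι P fz ≡ v) → Σ ℕ λ q → induced S ≅ copies q C₄
      peel-square v∈S (P , refl) =
        suc (proj₁ rest) , ≅-trans {induced S} {C₄ ⊕ induced (S ∖P)} {C₄ ⊕ copies (proj₁ rest) C₄}
                             (peel P⊆S) (⊕-congˡ C₄ (proj₂ rest))
        where
        open Peel P
        P⊆S : ∀ s → S (Piece.ι P s) ≡ true
        P⊆S = C₄-inside S-closed P v∈S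
        rest : Σ ℕ λ q → induced (S ∖P) ≅ copies q C₄
        rest = go bound (S ∖P) (ℕP.≤-trans (size-∖P P⊆S fz) (ℕP.≤-pred size<bound))
                  (∖P-closed S-closed) (λ v∈S′ → squares (∖P-⊆ S _ v∈S′))

-- The global structure: under the hypotheses of the local analysis the graph
-- is J ⊕ q·C₄ with J ∈ {∅, K₁, K₂, P₂}.
module Classification {n : ℕ} (G : SimpleGraph n) (5≤n : 5 ≤ n)
  (noThree : SimpleGraphProps.NoThreeEdges G)
  (sparse : sum (SimpleGraphProps.deg G) ≤ n * 2) where
  open SimpleGraphProps G
  open LocalStructure G 5≤n noThree sparse
  open Pieces G

  -- A vertex of degree 2 whose neighbours have degree 2 lies on a 4-cycle
  -- v – x – w – y – v that is a whole component.
  square-piece : ∀ {v} → 2 ≤ deg v → (∀ {x} → v ~ x → 2 ≤ deg x) → Σ (Piece C₄) λ P → Piece.ι P fz ≡ v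
  square-piece {v} 2≤deg 2≤deg-nbr with some-neighbour (ℕP.≤-trans (s≤s z≤n) 2≤deg)
  ... | x , v~x with other-neighbour 2≤deg v~x
  ...   | y , y≢x , v~y with other-neighbour (2≤deg-nbr v~x) (~-sym v~x)
  ...     | w , w≢v , x~w = record
            { ι = ι ; ι-injective = injective ; image? = fin-image? ι
            ; ι-adj = adj-from-table C₄-adj? table ; closed = closed } , refl
    where
    open Square v~x v~y y≢x x~w w≢v
    x≁y : adj x y ≡ false
    x≁y = common-neighbour⇒non-adjacent v~x v~y
    ι : Fin 4 → Fin n
    ι = v ∷ x ∷ w ∷ y ∷ []
    table : ∀ s t → adj (ι s) (ι t) ≡ does (C₄-adj? s t)
    table fz fz = adj-irrefl v
    table fz (fs fz) = v~x
    table fz (fs (fs fz)) = trans (adj-sym v w) w≁v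
    table fz (fs (fs (fs fz))) = v~y
    table (fs fz) fz = ~-sym v~x
    table (fs fz) (fs fz) = adj-irrefl x
    table (fs fz) (fs (fs fz)) = x~w
    table (fs fz) (fs (fs (fs fz))) = x≁y
    table (fs (fs fz)) fz = w≁v
    table (fs (fs fz)) (fs fz) = ~-sym x~w
    table (fs (fs fz)) (fs (fs fz)) = adj-irrefl w
    table (fs (fs fz)) (fs (fs (fs fz))) = w~y
    table (fs (fs (fs fz))) fz = ~-sym v~y
    table (fs (fs (fs fz))) (fs fz) = trans (adj-sym y x) x≁y
    table (fs (fs (fs fz))) (fs (fs fz)) = ~-sym w~y
    table (fs (fs (fs fz))) (fs (fs (fs fz))) = adj-irrefl y
    injective : ∀ {s t} → ι s ≡ ι t → s ≡ t
    injective {fz} {fz} _ = refl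
    injective {fz} {fs fz} v≡x = ⊥-elim (~⇒≢ v~x v≡x)
    injective {fz} {fs (fs fz)} v≡w = ⊥-elim (w≢v (sym v≡w))
    injective {fz} {fs (fs (fs fz))} v≡y = ⊥-elim (~⇒≢ v~y v≡y)
    injective {fs fz} {fz} x≡v = ⊥-elim (~⇒≢ v~x (sym x≡v))
    injective {fs fz} {fs fz} _ = refl
    injective {fs fz} {fs (fs fz)} x≡w = ⊥-elim (~⇒≢ x~w x≡w)
    injective {fs fz} {fs (fs (fs fz))} x≡y = ⊥-elim (y≢x (sym x≡y))
    injective {fs (fs fz)} {fz} w≡v = ⊥-elim (w≢v w≡v)
    injective {fs (fs fz)} {fs fz} w≡x = ⊥-elim (~⇒≢ x~w (sym w≡x))
    injective {fs (fs fz)} {fs (fs fz)} _ = refl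
    injective {fs (fs fz)} {fs (fs (fs fz))} w≡y = ⊥-elim (w≢y w≡y)
    injective {fs (fs (fs fz))} {fz} y≡v = ⊥-elim (~⇒≢ v~y (sym y≡v))
    injective {fs (fs (fs fz))} {fs fz} y≡x = ⊥-elim (y≢x y≡x)
    injective {fs (fs (fs fz))} {fs (fs fz)} y≡w = ⊥-elim (w≢y (sym y≡w))
    injective {fs (fs (fs fz))} {fs (fs (fs fz))} _ = refl
    -- every vertex of the square has its two square-neighbours as only neighbours
    one-of : ∀ {u} (s t : Fin 4) → u ≡ ι s ⊎ u ≡ ι t → Σ (Fin 4) λ r → ι r ≡ u
    one-of s t (inj₁ u≡ιs) = s , sym u≡ιs
    one-of s t (inj₂ u≡ιt) = t , sym u≡ιt
    closed : ∀ s {u} → ι s ~ u → Σ (Fin 4) λ r → ι r ≡ u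
    closed fz v~u = one-of (fs fz) (fs (fs (fs fz))) (neighbours≤2 v~x v~y y≢x v~u)
    closed (fs fz) x~u = one-of fz (fs (fs fz)) (neighbours≤2 (~-sym v~x) x~w w≢v x~u)
    closed (fs (fs fz)) w~u = one-of (fs fz) (fs (fs (fs fz))) (neighbours≤2 (~-sym x~w) w~y y≢x w~u)
    closed (fs (fs (fs fz))) y~u = one-of fz (fs (fs fz)) (neighbours≤2 (~-sym v~y) (~-sym w~y) w≢v y~u)

  -- The candidate pieces J: nothing, an isolated vertex, an isolated edge, or
  -- a path z – c – w whose ends have degree at most 1.
  ∅-piece : Piece emptyGraph
  ∅-piece = record { ι = λ () ; ι-injective = λ {} ; image? = λ _ → no (λ ()) ; ι-adj = λ ()
                   ; closed = λ () }

  K₁-piece : ∀ {z} → deg z ≡ 0 → Piece K₁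
  K₁-piece {z} deg≡0 = record
    { ι = λ _ → z ; ι-injective = λ _ → refl
    ; image? = λ v → Dec.map′ (tt ,_) proj₂ (z FinP.≟ v)
    ; ι-adj = λ _ _ → mk⇔ (λ ()) (λ z~z → ~⇒≢ z~z refl)
    ; closed = λ _ z~u → ⊥-elim (ℕP.<-irrefl (sym deg≡0) (deg-≥₁ z~u)) }

  K₂-piece : ∀ {z w} → deg z ≤ 1 → deg w ≤ 1 → z ~ w → Piece K₂
  K₂-piece {z} {w} z≤1 w≤1 z~w = record
    { ι = ι ; ι-injective = injective ; image? = fin-image? ι
    ; ι-adj = adj-from-table K₂-adj? table ; closed = closed }
    where
    ι : Fin 2 → Fin n
    ι = z ∷ w ∷ []
    table : ∀ s t → adj (ι s) (ι t) ≡ does (K₂-adj? s t)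
    table fz fz = adj-irrefl z
    table fz (fs fz) = z~w
    table (fs fz) fz = ~-sym z~w
    table (fs fz) (fs fz) = adj-irrefl w
    injective : ∀ {s t} → ι s ≡ ι t → s ≡ t
    injective {fz} {fz} _ = refl
    injective {fz} {fs fz} z≡w = ⊥-elim (~⇒≢ z~w z≡w)
    injective {fs fz} {fz} w≡z = ⊥-elim (~⇒≢ z~w (sym w≡z))
    injective {fs fz} {fs fz} _ = refl
    closed : ∀ s {u} → ι s ~ u → Σ (Fin 2) λ r → ι r ≡ u
    closed fz z~u = fs fz , sym (neighbour≤1 z≤1 z~w z~u)
    closed (fs fz) w~u = fz , sym (neighbour≤1 w≤1 (~-sym z~w) w~u)

  P₂-piece : ∀ {z c w} → deg z ≤ 1 → deg w ≤ 1 → z ~ c → c ~ w → w ≢ z → Piece P₂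
  P₂-piece {z} {c} {w} z≤1 w≤1 z~c c~w w≢z = record
    { ι = ι ; ι-injective = injective ; image? = fin-image? ι
    ; ι-adj = adj-from-table P₂-adj? table ; closed = closed }
    where
    z≁w : adj z w ≡ false
    z≁w = common-neighbour⇒non-adjacent (~-sym z~c) c~w
    ι : Fin 3 → Fin n
    ι = z ∷ c ∷ w ∷ []
    table : ∀ s t → adj (ι s) (ι t) ≡ does (P₂-adj? s t)
    table fz fz = adj-irrefl z
    table fz (fs fz) = z~c
    table fz (fs (fs fz)) = z≁w
    table (fs fz) fz = ~-sym z~c
    table (fs fz) (fs fz) = adj-irrefl c
    table (fs fz) (fs (fs fz)) = c~w
    table (fs (fs fz)) fz = trans (adj-sym w z) z≁w
    table (fs (fs fz)) (fs fz) = ~-sym c~w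
    table (fs (fs fz)) (fs (fs fz)) = adj-irrefl w
    injective : ∀ {s t} → ι s ≡ ι t → s ≡ t
    injective {fz} {fz} _ = refl
    injective {fz} {fs fz} z≡c = ⊥-elim (~⇒≢ z~c z≡c)
    injective {fz} {fs (fs fz)} z≡w = ⊥-elim (w≢z (sym z≡w))
    injective {fs fz} {fz} c≡z = ⊥-elim (~⇒≢ z~c (sym c≡z))
    injective {fs fz} {fs fz} _ = refl
    injective {fs fz} {fs (fs fz)} c≡w = ⊥-elim (~⇒≢ c~w c≡w)
    injective {fs (fs fz)} {fz} w≡z = ⊥-elim (w≢z w≡z)
    injective {fs (fs fz)} {fs fz} w≡c = ⊥-elim (~⇒≢ c~w (sym w≡c))
    injective {fs (fs fz)} {fs (fs fz)} _ = refl
    closed : ∀ s {u} → ι s ~ u → Σ (Fin 3) λ r → ι r ≡ u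
    closed fz z~u = fs fz , sym (neighbour≤1 z≤1 z~c z~u)
    closed (fs fz) c~u with neighbours≤2 (~-sym z~c) c~w w≢z c~u
    ... | inj₁ u≡z = fz , sym u≡z
    ... | inj₂ u≡w = fs (fs fz) , sym u≡w
    closed (fs (fs fz)) w~u = fs fz , sym (neighbour≤1 w≤1 (~-sym c~w) w~u)

  -- G is J ⊕ q·C₄ as soon as a piece J contains every vertex of degree < 2:
  -- outside J all degrees are 2, so every remaining vertex lies on a square.
  assemble : ∀ {J} (P : Piece J) → (∀ {v} → ¬ (Σ (Vertex J) λ s → Piece.ι P s ≡ v) → 2 ≤ deg v) →
             Decomposition J
  assemble {J} P 2≤deg-outside = q , ≅-trans {induced everything} {J ⊕ induced rest} {J ⊕ copies q C₄}
                                       (peel (λ _ → refl)) (⊕-congˡ J rest≅)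
    where
    open Peel P
    rest : Fin n → Bool
    rest = everything ∖P
    rest-closed : Closed rest
    rest-closed = ∖P-closed (λ _ _ → refl)
    2≤deg-rest : ∀ {v} → rest v ≡ true → 2 ≤ deg v
    2≤deg-rest {v} v∈rest = 2≤deg-outside (λ { (s , refl) → false≢true (trans (sym (∖P-ι everything s)) v∈rest) })
    decomposition : Σ ℕ λ q → induced rest ≅ copies q C₄
    decomposition = decompose rest-closed
      (λ v∈rest → square-piece (2≤deg-rest v∈rest) (λ v~x → 2≤deg-rest (rest-closed v∈rest v~x)))
    q : ℕ
    q = proj₁ decomposition
    rest≅ : induced rest ≅ copies q C₄
    rest≅ = proj₂ decomposition

  -- The defect 2 ∸ deg v of a vertex; the defects add up to 2n minus the degree sum.
  defect : Fin n → ℕ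
  defect v = 2 ∸ deg v

  defect-sum : sum defect + sum deg ≡ n * 2
  defect-sum = begin
    sum defect + sum deg         ≡⟨ sym (∑-distrib-+ defect deg) ⟩
    sum (λ v → defect v + deg v) ≡⟨ sum-cong-≗ (λ v → ℕP.m∸n+n≡m (deg≤2 v)) ⟩
    sum {n} (λ _ → 2)            ≡⟨ sum-const n 2 ⟩
    n * 2                        ∎
    where open ≡-Reasoning

  no-defect : ∀ {v} → defect v ≡ 0 → 2 ≤ deg v
  no-defect = ℕP.m∸n≡0⇒m≤n

  -- Degree sum 2n: every degree is 2, and G is a union of squares.
  regular-case : sum deg ≡ n * 2 → Decomposition emptyGraph
  regular-case deg-sum = assemble ∅-piece (λ {v} _ → no-defect (zero-sum⇒zero defect no-defects v))
    where
    no-defects : sum defect ≡ 0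
    no-defects = ℕP.+-cancelʳ-≡ (sum deg) (sum defect) 0 (trans defect-sum (sym deg-sum))

  -- Degree sum 2n − 2, first case: one isolated vertex z carries the whole
  -- defect 2, so every other vertex has degree 2.
  isolated-case : sum defect ≡ 2 → ∀ {z} → deg z ≡ 0 → Decomposition K₁
  isolated-case two {z} deg≡0 = assemble (K₁-piece deg≡0) (λ {v} v∉ → no-defect (others (λ v≡z → v∉ (tt , sym v≡z))))
    where
    others : ∀ {v} → v ≢ z → defect v ≡ 0
    others {v} v≢z = ℕP.n≤0⇒n≡0 (ℕP.+-cancelˡ-≤ 2 (defect v) 0 (begin
      2 + defect v          ≡⟨ cong (λ d → 2 ∸ d + defect v) (sym deg≡0) ⟩
      defect z + defect v   ≤⟨ sum-≥₂ defect v≢z ⟩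
      sum defect            ≡⟨ two ⟩
      2                     ∎))
      where open ℕP.≤-Reasoning

  -- Second case: two leaves z and w, all other degrees 2. Following the path
  -- from z, it reaches w after one or two steps (K₂ or P₂), since a third step
  -- would create a path z – c – y – w′ from a leaf.
  two-leaves : ∀ {z c w} → deg z ≤ 1 → deg w ≤ 1 → z ~ c → w ≢ z → (∀ {t} → t ≢ z → t ≢ w → 2 ≤ deg t) →
               Decomposition K₂ ⊎ Decomposition P₂
  two-leaves {z} {c} {w} z≤1 w≤1 z~c w≢z others with c FinP.≟ w
  ... | yes refl = inj₁ (assemble (K₂-piece z≤1 w≤1 z~c)
                     (λ {v} v∉ → others (λ v≡z → v∉ (fz , sym v≡z)) (λ v≡w → v∉ (fs fz , sym v≡w))))
  ... | no c≢w with other-neighbour (others (≢-sym (~⇒≢ z~c)) c≢w) (~-sym z~c)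
  ...   | y , y≢z , c~y with y FinP.≟ w
  ...     | yes refl = inj₂ (assemble (P₂-piece z≤1 w≤1 z~c c~y w≢z)
                         (λ {v} v∉ → others (λ v≡z → v∉ (fz , sym v≡z)) (λ v≡w → v∉ (fs (fs fz) , sym v≡w))))
  ...     | no y≢w with other-neighbour (others y≢z y≢w) (~-sym c~y)
  ...       | w′ , w′≢c , y~w′ = ⊥-elim (leaf-path z≤1 z~c c~y y≢z y~w′ w′≢c)

  leaves-case : sum defect ≡ 2 → ∀ {z} → deg z ≡ 1 → Decomposition K₂ ⊎ Decomposition P₂
  leaves-case two {z} deg≡1 with second-summand defect (ℕP.≤-reflexive (cong (2 ∸_) deg≡1)) (ℕP.≤-reflexive (sym two))
  ... | w , w≢z , dw≢0 = two-leaves (ℕP.≤-reflexive deg≡1) (ℕP.≤-pred (ℕP.m∸n≢0⇒n<m dw≢0))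
                           (proj₂ (some-neighbour (ℕP.≤-reflexive (sym deg≡1)))) w≢z others
    where
    others : ∀ {t} → t ≢ z → t ≢ w → 2 ≤ deg t
    others {t} t≢z t≢w = no-defect (ℕP.n≤0⇒n≡0 (ℕP.+-cancelˡ-≤ 2 (defect t) 0 (begin
      2 + defect t                       ≤⟨ ℕP.+-monoˡ-≤ (defect t) (ℕP.+-monoʳ-≤ 1 (ℕP.n≢0⇒n>0 dw≢0)) ⟩
      1 + defect w + defect t            ≡⟨ cong (λ d → 2 ∸ d + defect w + defect t) (sym deg≡1) ⟩
      defect z + defect w + defect t     ≤⟨ sum-≥₃ defect w≢z t≢z t≢w ⟩
      sum defect                         ≡⟨ two ⟩
      2                                  ∎)))
      where open ℕP.≤-Reasoning

  deficient-case : sum deg + 2 ≡ n * 2 → Decomposition K₁ ⊎ Decomposition K₂ ⊎ Decomposition P₂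
  deficient-case deg-sum = by-defect-vertex (ℕP.+-cancelʳ-≡ (sum deg) (sum defect) 2
                             (trans defect-sum (trans (sym deg-sum) (ℕP.+-comm (sum deg) 2))))
    where
    by-defect-vertex : sum defect ≡ 2 → Decomposition K₁ ⊎ Decomposition K₂ ⊎ Decomposition P₂
    by-defect-vertex two with nonzero-summand defect (λ none → 2≢0 (trans (sym two) none))
      where
      2≢0 : 2 ≢ 0
      2≢0 ()
    ... | z , defect≢0 with deg z in deg-z
    ...   | 0 = inj₁ (isolated-case two deg-z)
    ...   | 1 = inj₂ (leaves-case two deg-z)
    ...   | suc (suc k) = ⊥-elim (defect≢0 (ℕP.0∸n≡0 k))

-- Positivity of a sign, and uniqueness of proofs of equalities of signs.
isPlus : Sign → Bool
isPlus Sign.+ = true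
isPlus Sign.- = false

isPlus-true : ∀ {s} → isPlus s ≡ true → s ≡ Sign.+
isPlus-true {Sign.+} _ = refl

sign-irrelevant : ∀ {s t : Sign} (p q : s ≡ t) → p ≡ q
sign-irrelevant = Decidable⇒UIP.≡-irrelevant SignP._≟_

-- Six signs add up to 0 exactly when three of them are positive (checked by
-- evaluating all 64 cases).
six-signs : ∀ s₁ s₂ s₃ s₄ s₅ s₆ →
  (signℤ s₁ ℤ.+ signℤ s₂ ℤ.+ signℤ s₃ ℤ.+ signℤ s₄ ℤ.+ signℤ s₅ ℤ.+ signℤ s₆ ≡ ℤ.+ 0) ⇔
  (χ (isPlus s₁) + χ (isPlus s₂) + χ (isPlus s₃) + χ (isPlus s₄) + χ (isPlus s₅) + χ (isPlus s₆) ≡ 3)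
six-signs = Dec.from-yes
  (all-Sign? λ s₁ → all-Sign? λ s₂ → all-Sign? λ s₃ → all-Sign? λ s₄ → all-Sign? λ s₅ → all-Sign? λ s₆ →
     (signℤ s₁ ℤ.+ signℤ s₂ ℤ.+ signℤ s₃ ℤ.+ signℤ s₄ ℤ.+ signℤ s₅ ℤ.+ signℤ s₆ ℤ.≟ ℤ.+ 0) ⇔?
     (χ (isPlus s₁) + χ (isPlus s₂) + χ (isPlus s₃) + χ (isPlus s₄) + χ (isPlus s₅) + χ (isPlus s₆) ℕ.≟ 3))

-- The positive edges of a weighting form a simple graph on Fin n, whose
-- adjacency is read off from the edge {u, v} stored with its smaller vertex first.
module PositiveGraph {n : ℕ} (f : Weighting n) where

  positive? : Fin n → Fin n → Bool
  positive? u v with FinP.<-cmp u v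
  ... | tri< u<v _ _ = isPlus (f (edge u v u<v))
  ... | tri≈ _ _ _ = false
  ... | tri> _ _ v<u = isPlus (f (edge v u v<u))

  positive?-< : ∀ {u v} (u<v : u Fin.< v) → positive? u v ≡ isPlus (f (edge u v u<v))
  positive?-< {u} {v} u<v with FinP.<-cmp u v
  ... | tri< u<v′ _ _ = cong (λ p → isPlus (f (edge u v p))) (FinP.<-irrelevant u<v′ u<v)
  ... | tri≈ _ u≡v _ = ⊥-elim (FinP.<-irrefl u≡v u<v)
  ... | tri> _ _ v<u = ⊥-elim (FinP.<-asym u<v v<u)

  positive?-> : ∀ {u v} (v<u : v Fin.< u) → positive? u v ≡ isPlus (f (edge v u v<u))
  positive?-> {u} {v} v<u with FinP.<-cmp u v
  ... | tri< u<v _ _ = ⊥-elim (FinP.<-asym u<v v<u)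
  ... | tri≈ _ u≡v _ = ⊥-elim (FinP.<-irrefl (sym u≡v) v<u)
  ... | tri> _ _ v<u′ = cong (λ p → isPlus (f (edge v u p))) (FinP.<-irrelevant v<u′ v<u)

  positive?-irrefl : ∀ u → positive? u u ≡ false
  positive?-irrefl u with FinP.<-cmp u u
  ... | tri< u<u _ _ = ⊥-elim (FinP.<-irrefl refl u<u)
  ... | tri≈ _ _ _ = refl
  ... | tri> _ _ u<u = ⊥-elim (FinP.<-irrefl refl u<u)

  positive?-sym : ∀ u v → positive? u v ≡ positive? v u
  positive?-sym u v with FinP.<-cmp u v
  ... | tri< u<v _ _ = sym (positive?-> u<v)
  ... | tri≈ _ refl _ = sym (positive?-irrefl u)
  ... | tri> _ _ v<u = sym (positive?-< v<u)

  positive : SimpleGraph n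
  positive = record { adj = positive? ; adj-sym = positive?-sym ; adj-irrefl = positive?-irrefl }

  open SimpleGraphProps positive

  -- The graph posGraph f of the statement has exactly this adjacency, and
  -- its adjacency proofs are unique.
  posGraph-adj : ∀ u v → Adj (posGraph f) u v ⇔ (u ~ v)
  posGraph-adj u v = mk⇔ to from
    where
    to : Adj (posGraph f) u v → u ~ v
    to (inj₁ (u<v , fuv≡+)) = trans (positive?-< u<v) (cong isPlus fuv≡+)
    to (inj₂ (v<u , fvu≡+)) = trans (positive?-> v<u) (cong isPlus fvu≡+)
    from : u ~ v → Adj (posGraph f) u v
    from u~v = by-order (FinP.<-cmp u v)
      where
      by-order : Tri (u Fin.< v) (u ≡ v) (v Fin.< u) → Adj (posGraph f) u v
      by-order (tri< u<v _ _) = inj₁ (u<v , isPlus-true (trans (sym (positive?-< u<v)) u~v))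
      by-order (tri≈ _ u≡v _) = ⊥-elim (~⇒≢ u~v u≡v)
      by-order (tri> _ _ v<u) = inj₂ (v<u , isPlus-true (trans (sym (positive?-> v<u)) u~v))

  posGraph-adj-irrelevant : ∀ {u v} (p q : Adj (posGraph f) u v) → p ≡ q
  posGraph-adj-irrelevant (inj₁ (u<v , e)) (inj₁ (u<v′ , e′)) with FinP.<-irrelevant u<v u<v′
  ... | refl = cong (λ e → inj₁ (u<v , e)) (sign-irrelevant e e′)
  posGraph-adj-irrelevant (inj₁ (u<v , _)) (inj₂ (v<u , _)) = ⊥-elim (FinP.<-asym u<v v<u)
  posGraph-adj-irrelevant (inj₂ (v<u , _)) (inj₁ (u<v , _)) = ⊥-elim (FinP.<-asym u<v v<u)
  posGraph-adj-irrelevant (inj₂ (v<u , e)) (inj₂ (v<u′ , e′)) with FinP.<-irrelevant v<u v<u′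
  ... | refl = cong (λ e → inj₂ (v<u , e)) (sign-irrelevant e e′)

  -- Handshake lemma: ordered pairs of adjacent vertices are counted once by
  -- the degree sum and twice by the positive edges.
  handshake : ∀ {m} → PosCount f m → sum deg ≡ m + m
  handshake {m} count = ↔⇒≡ (↔-trans (↔-sym by-degrees) (↔-trans by-edges (↔-sym (FinP.+↔⊎ {m} {m}))))
    where
    OrderedPairs : Set
    OrderedPairs = Σ (Fin n) λ u → Σ (Fin n) λ v → Adj (posGraph f) u v
    PositiveEdges : Set
    PositiveEdges = Σ (Edge n) λ e → f e ≡ Sign.+

    by-degrees : OrderedPairs ↔ Fin (sum deg)
    by-degrees = Σ-↔-sum deg λ u → Σ-↔-sum (χ ∘ adj u) λ v →
                   prop-↔-χ posGraph-adj-irrelevant (posGraph-adj u v)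

    by-edges : OrderedPairs ↔ (Fin m ⊎ Fin m)
    by-edges = ↔-trans (mk↔ₛ′ to from to∘from from∘to) (count ⊎-↔ count)
      where
      to : OrderedPairs → PositiveEdges ⊎ PositiveEdges
      to (u , v , inj₁ (u<v , e)) = inj₁ (edge u v u<v , e)
      to (u , v , inj₂ (v<u , e)) = inj₂ (edge v u v<u , e)
      from : PositiveEdges ⊎ PositiveEdges → OrderedPairs
      from (inj₁ (edge a b a<b , e)) = a , b , inj₁ (a<b , e)
      from (inj₂ (edge a b a<b , e)) = b , a , inj₂ (a<b , e)
      to∘from : ∀ x → to (from x) ≡ x
      to∘from (inj₁ _) = refl
      to∘from (inj₂ _) = refl
      from∘to : ∀ x → from (to x) ≡ x
      from∘to (_ , _ , inj₁ _) = refl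
      from∘to (_ , _ , inj₂ _) = refl

  -- On an increasing quadruple, the K₄ has weight 0 exactly when three of its
  -- edges are positive.
  K4weight-zero⇔three : ∀ {a b c d} (a<b : a Fin.< b) (b<c : b Fin.< c) (c<d : c Fin.< d) →
                        (K4weight f a b c d a<b b<c c<d ≡ ℤ.+ 0) ⇔ (edges4 a b c d ≡ 3)
  K4weight-zero⇔three {a} {b} {c} {d} a<b b<c c<d =
    subst (λ k → (K4weight f a b c d a<b b<c c<d ≡ ℤ.+ 0) ⇔ (k ≡ 3)) (sym edges-as-signs)
      (six-signs (f (edge a b a<b)) (f (edge a c a<c)) (f (edge a d a<d))
                 (f (edge b c b<c)) (f (edge b d b<d)) (f (edge c d c<d)))
    where
    a<c : a Fin.< c
    a<c = FinP.<-trans a<b b<c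
    b<d : b Fin.< d
    b<d = FinP.<-trans b<c c<d
    a<d : a Fin.< d
    a<d = FinP.<-trans a<b b<d
    p : ∀ {u v} → u Fin.< v → ℕ
    p u<v = χ (isPlus (f (edge _ _ u<v)))
    edges-as-signs : edges4 a b c d ≡ p a<b + p a<c + p a<d + p b<c + p b<d + p c<d
    edges-as-signs =
      cong₂ _+_ (cong₂ _+_ (cong₂ _+_ (cong₂ _+_ (cong₂ _+_
        (cong χ (positive?-< a<b)) (cong χ (positive?-< a<c))) (cong χ (positive?-< a<d)))
        (cong χ (positive?-< b<c))) (cong χ (positive?-< b<d))) (cong χ (positive?-< c<d))

  -- Hence f has no zero-sum K₄ exactly when no four vertices span exactly
  -- three positive edges.
  no-zero-sum⇔noThree : (¬ ZeroSumK4 f) ⇔ NoThreeEdges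
  no-zero-sum⇔noThree = mk⇔ to from
    where
    to : ¬ ZeroSumK4 f → NoThreeEdges
    to no-zero = noThreeEdges-increasing λ {a} {b} {c} {d} a<b b<c c<d three →
      no-zero (a , b , c , d , a<b , b<c , c<d , Equivalence.from (K4weight-zero⇔three a<b b<c c<d) three)
    from : NoThreeEdges → ¬ ZeroSumK4 f
    from noThree (a , b , c , d , a<b , b<c , c<d , weight≡0) =
      noThree (FinP.<⇒≢ a<b) (FinP.<⇒≢ a<c) (FinP.<⇒≢ (FinP.<-trans a<c c<d))
              (FinP.<⇒≢ b<c) (FinP.<⇒≢ (FinP.<-trans b<c c<d)) (FinP.<⇒≢ c<d)
              (Equivalence.to (K4weight-zero⇔three a<b b<c c<d) weight≡0)
      where
      a<c : a Fin.< c
      a<c = FinP.<-trans a<b b<c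

-- The converse direction. The graphs J ⊕ q·C₄ are labelled graphs: every
-- vertex carries a component and a side, two vertices are adjacent exactly
-- when they lie in the same component on different sides, and no component
-- has three vertices on one side.
record Labelled (H : Graph) : Set where
  field
    component : Vertex H → ℕ
    side : Vertex H → Bool
    adj⇔ : ∀ x y → Adj H x y ⇔ (component x ≡ component y × side x xor side y ≡ true)
    side≤2 : ∀ x y z → component x ≡ component y → component x ≡ component z →
             side x ≡ side y → side x ≡ side z → x ≡ y ⊎ x ≡ z ⊎ y ≡ z

-- A single component: a complete bipartite graph with sides of size at most 2.
record Bipartite≤2 (K : Graph) : Set where
  field
    side : Vertex K → Bool
    adj⇔ : ∀ x y → Adj K x y ⇔ (side x xor side y ≡ true)
    side≤2 : ∀ x y z → side x ≡ side y → side x ≡ side z → x ≡ y ⊎ x ≡ z ⊎ y ≡ z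

∅-labelled : Labelled emptyGraph
∅-labelled = record { component = λ () ; side = λ () ; adj⇔ = λ () ; side≤2 = λ () }

-- Adding one more component, with a fresh label.
⊕-labelled : ∀ {K H} → Bipartite≤2 K → Labelled H → Labelled (K ⊕ H)
⊕-labelled {K} {H} bK lH = record { component = component ; side = side ; adj⇔ = adj⇔ ; side≤2 = side≤2 }
  where
  module K = Bipartite≤2 bK
  module H = Labelled lH
  component : Vertex (K ⊕ H) → ℕ
  component (inj₁ _) = 0
  component (inj₂ y) = suc (H.component y)
  side : Vertex (K ⊕ H) → Bool
  side (inj₁ x) = K.side x
  side (inj₂ y) = H.side y
  adj⇔ : ∀ x y → Adj (K ⊕ H) x y ⇔ (component x ≡ component y × side x xor side y ≡ true)
  adj⇔ (inj₁ x) (inj₁ y) = mk⇔ (λ x-y → refl , Equivalence.to (K.adj⇔ x y) x-y) (Equivalence.from (K.adj⇔ x y) ∘ proj₂)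
  adj⇔ (inj₁ x) (inj₂ y) = mk⇔ (λ ()) (λ ())
  adj⇔ (inj₂ x) (inj₁ y) = mk⇔ (λ ()) (λ ())
  adj⇔ (inj₂ x) (inj₂ y) = mk⇔
    (λ x-y → Product.map₁ (cong suc) (Equivalence.to (H.adj⇔ x y) x-y))
    (λ (same , sides) → Equivalence.from (H.adj⇔ x y) (ℕP.suc-injective same , sides))
  side≤2 : ∀ x y z → component x ≡ component y → component x ≡ component z →
           side x ≡ side y → side x ≡ side z → x ≡ y ⊎ x ≡ z ⊎ y ≡ z
  side≤2 (inj₁ x) (inj₁ y) (inj₁ z) _ _ xy xz = Sum.map (cong inj₁) (Sum.map (cong inj₁) (cong inj₁)) (K.side≤2 x y z xy xz)
  side≤2 (inj₂ x) (inj₂ y) (inj₂ z) cxy cxz xy xz = Sum.map (cong inj₂) (Sum.map (cong inj₂) (cong inj₂))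
    (H.side≤2 x y z (ℕP.suc-injective cxy) (ℕP.suc-injective cxz) xy xz)

copies-labelled : ∀ {K} → Bipartite≤2 K → ∀ q → Labelled (copies q K)
copies-labelled bK zero = ∅-labelled
copies-labelled bK (suc q) = ⊕-labelled bK (copies-labelled bK q)

-- The five components of the statement; for K₂, P₂ and C₄ both properties
-- are finite checks.
∅-bipartite : Bipartite≤2 emptyGraph
∅-bipartite = record { side = λ () ; adj⇔ = λ () ; side≤2 = λ () }

K₁-bipartite : Bipartite≤2 K₁
K₁-bipartite = record { side = λ _ → false ; adj⇔ = λ _ _ → mk⇔ (λ ()) (λ ()) ; side≤2 = λ _ _ _ _ _ → inj₁ refl }

fin-bipartite : ∀ {k} {A : Fin k → Fin k → Set} (A? : ∀ i j → Dec (A i j)) (side : Fin k → Bool) →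
                (∀ i j → does (A? i j) ≡ side i xor side j) →
                (∀ i j l → side i ≡ side j → side i ≡ side l → i ≡ j ⊎ i ≡ l ⊎ j ≡ l) →
                Bipartite≤2 (record { Vertex = Fin k ; Adj = A })
fin-bipartite {A = A} A? side table side≤2 = record
  { side = side
  ; adj⇔ = λ i j → subst (λ b → A i j ⇔ (b ≡ true)) (table i j) (does⇔ (A? i j))
  ; side≤2 = side≤2 }

-- the finite checks: the adjacency table against the sides, and sides of size ≤ 2
module _ {k : ℕ} {A : Fin k → Fin k → Set} (A? : ∀ i j → Dec (A i j)) (side : Fin k → Bool) where
  table? : Dec (∀ i j → does (A? i j) ≡ side i xor side j)
  table? = FinP.all? λ i → FinP.all? λ j → does (A? i j) BoolP.≟ side i xor side j

  side≤2? : Dec (∀ i j l → side i ≡ side j → side i ≡ side l → i ≡ j ⊎ i ≡ l ⊎ j ≡ l)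
  side≤2? = FinP.all? λ i → FinP.all? λ j → FinP.all? λ l →
    (side i BoolP.≟ side j) →-dec (side i BoolP.≟ side l) →-dec ((i FinP.≟ j) ⊎-dec (i FinP.≟ l) ⊎-dec (j FinP.≟ l))

K₂-bipartite : Bipartite≤2 K₂
K₂-bipartite = fin-bipartite K₂-adj? side (Dec.from-yes (table? K₂-adj? side)) (Dec.from-yes (side≤2? K₂-adj? side))
  where
  side : Fin 2 → Bool
  side = false ∷ true ∷ []

P₂-bipartite : Bipartite≤2 P₂
P₂-bipartite = fin-bipartite P₂-adj? side (Dec.from-yes (table? P₂-adj? side)) (Dec.from-yes (side≤2? P₂-adj? side))
  where
  side : Fin 3 → Bool
  side = false ∷ true ∷ false ∷ []

C₄-bipartite : Bipartite≤2 C₄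
C₄-bipartite = fin-bipartite C₄-adj? side (Dec.from-yes (table? C₄-adj? side)) (Dec.from-yes (side≤2? C₄-adj? side))
  where
  side : Fin 4 → Bool
  side = false ∷ true ∷ false ∷ true ∷ []

-- Labellings transport along graph isomorphisms.
transport-labelled : ∀ {G H} → G ≅ H → Labelled H → Labelled G
transport-labelled {G} {H} (φ , φ-adj) lH = record
  { component = H.component ∘ to ; side = H.side ∘ to
  ; adj⇔ = λ x y → H.adj⇔ (to x) (to y) ⇔-∘ φ-adj x y
  ; side≤2 = λ x y z cxy cxz sxy sxz →
      Sum.map injective (Sum.map injective injective) (H.side≤2 (to x) (to y) (to z) cxy cxz sxy sxz) }
  where
  module H = Labelled lH
  to : Vertex G → Vertex H
  to = Inverse.to φ
  injective : ∀ {x y} → to x ≡ to y → x ≡ y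
  injective {x} {y} tx≡ty = trans (sym (Inverse.strictlyInverseʳ φ x))
                                  (trans (cong (Inverse.from φ) tx≡ty) (Inverse.strictlyInverseʳ φ y))

-- The four-point check. Record for four points whether two of them share a
-- component (s, consistent: transitive) and their sides (p); if exactly three
-- pairs share a component on different sides, then three points share both a
-- component and a side. Checked by evaluating all 2¹⁰ cases.
infixr 4 _⇒ᵇ_
_⇒ᵇ_ : Bool → Bool → Bool
a ⇒ᵇ b = not a ∨ b

transitive3 : (sxy sxz syz : Bool) → Bool
transitive3 sxy sxz syz = (sxy ∧ syz ⇒ᵇ sxz) ∧ (sxy ∧ sxz ⇒ᵇ syz) ∧ (sxz ∧ syz ⇒ᵇ sxy)

crowded3 : (sxy sxz syz px py pz : Bool) → Bool
crowded3 sxy sxz syz px py pz = sxy ∧ sxz ∧ not (px xor py) ∧ not (px xor pz)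

linked : (s px py : Bool) → ℕ
linked s px py = χ (s ∧ (px xor py))

four-point : ∀ sab sac sad sbc sbd scd pa pb pc pd →
  T (transitive3 sab sac sbc ∧ transitive3 sab sad sbd ∧ transitive3 sac sad scd ∧ transitive3 sbc sbd scd) →
  linked sab pa pb + linked sac pa pc + linked sad pa pd + linked sbc pb pc + linked sbd pb pd + linked scd pc pd ≡ 3 →
  T (crowded3 sab sac sbc pa pb pc ∨ crowded3 sab sad sbd pa pb pd ∨ crowded3 sac sad scd pa pc pd ∨ crowded3 sbc sbd scd pb pc pd)
four-point = Dec.from-yes
  (all-Bool? λ sab → all-Bool? λ sac → all-Bool? λ sad → all-Bool? λ sbc → all-Bool? λ sbd → all-Bool? λ scd →
   all-Bool? λ pa → all-Bool? λ pb → all-Bool? λ pc → all-Bool? λ pd →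
     BoolP.T? (transitive3 sab sac sbc ∧ transitive3 sab sad sbd ∧ transitive3 sac sad scd ∧ transitive3 sbc sbd scd) →-dec
     (linked sab pa pb + linked sac pa pc + linked sad pa pd + linked sbc pb pc + linked sbd pb pd + linked scd pc pd ℕ.≟ 3) →-dec
     BoolP.T? (crowded3 sab sac sbc pa pb pc ∨ crowded3 sab sad sbd pa pb pd ∨ crowded3 sac sad scd pa pc pd ∨ crowded3 sbc sbd scd pb pc pd))

-- Boolean bookkeeping for the four-point check.
∧-intro : ∀ {a b} → T a → T b → T (a ∧ b)
∧-intro ta tb = Equivalence.from BoolP.T-∧ (ta , tb)

⇒ᵇ-intro : ∀ {a b c} → (T a → T b → T c) → T (a ∧ b ⇒ᵇ c)
⇒ᵇ-intro {true} {true} abc = abc tt tt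
⇒ᵇ-intro {true} {false} _ = tt
⇒ᵇ-intro {false} _ = tt

crowded3-elim : ∀ {sxy sxz syz} px py pz → T (crowded3 sxy sxz syz px py pz) → T sxy × T sxz × px ≡ py × px ≡ pz
crowded3-elim {true} {true} true true true _ = tt , tt , refl , refl
crowded3-elim {true} {true} false false false _ = tt , tt , refl , refl

-- A simple graph on Fin n as a graph in the sense of the statement.
asGraph : ∀ {n} → SimpleGraph n → Graph
asGraph {n} G = record { Vertex = Fin n ; Adj = SimpleGraphProps._~_ G }

-- A labelled simple graph has no four vertices spanning exactly three edges.
module LabelledNoThree {n : ℕ} (G : SimpleGraph n) (L : Labelled (asGraph G)) where
  open SimpleGraphProps G
  open Labelled L

  same : Fin n → Fin n → Bool
  same x y = does (component x ℕ.≟ component y)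

  same-sound : ∀ x y → T (same x y) → component x ≡ component y
  same-sound x y t = Equivalence.from (does⇔ (component x ℕ.≟ component y)) (Equivalence.to BoolP.T-≡ t)

  same-complete : ∀ x y → component x ≡ component y → T (same x y)
  same-complete x y cxy = Equivalence.from BoolP.T-≡ (dec-true (component x ℕ.≟ component y) cxy)

  adj-formula : ∀ x y → adj x y ≡ same x y ∧ (side x xor side y)
  adj-formula x y = BoolP.⇔→≡ (mk⇔ to from)
    where
    to : x ~ y → same x y ∧ (side x xor side y) ≡ true
    to x~y with Equivalence.to (adj⇔ x y) x~y
    ... | cxy , sides = Equivalence.to BoolP.T-≡ (∧-intro (same-complete x y cxy) (Equivalence.from BoolP.T-≡ sides))
    from : same x y ∧ (side x xor side y) ≡ true → x ~ y
    from t with Equivalence.to BoolP.T-∧ (Equivalence.from BoolP.T-≡ t)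
    ... | t-same , t-sides = Equivalence.from (adj⇔ x y) (same-sound x y t-same , Equivalence.to BoolP.T-≡ t-sides)

  transitive : ∀ x y z → T (transitive3 (same x y) (same x z) (same y z))
  transitive x y z =
    ∧-intro (⇒ᵇ-intro λ t-xy t-yz → same-complete x z (trans (same-sound x y t-xy) (same-sound y z t-yz)))
    (∧-intro (⇒ᵇ-intro λ t-xy t-xz → same-complete y z (trans (sym (same-sound x y t-xy)) (same-sound x z t-xz)))
             (⇒ᵇ-intro λ t-xz t-yz → same-complete x y (trans (same-sound x z t-xz) (sym (same-sound y z t-yz)))))

  not-crowded : ∀ {x y z} → x ≢ y → x ≢ z → y ≢ z → ¬ T (crowded3 (same x y) (same x z) (same y z) (side x) (side y) (side z))
  not-crowded {x} {y} {z} x≢y x≢z y≢z t with crowded3-elim {syz = same y z} (side x) (side y) (side z) t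
  ... | t-xy , t-xz , sxy , sxz =
    [ x≢y , [ x≢z , y≢z ]′ ]′ (side≤2 x y z (same-sound x y t-xy) (same-sound x z t-xz) sxy sxz)

  labelled⇒noThree : NoThreeEdges
  labelled⇒noThree {a} {b} {c} {d} a≢b a≢c a≢d b≢c b≢d c≢d three
    with Equivalence.to BoolP.T-∨ (four-point (same a b) (same a c) (same a d) (same b c) (same b d) (same c d)
                                             (side a) (side b) (side c) (side d)
           (∧-intro (transitive a b c) (∧-intro (transitive a b d) (∧-intro (transitive a c d) (transitive b c d))))
           (trans (sym as-linked) three))
    where
    as-linked : edges4 a b c d ≡ linked (same a b) (side a) (side b) + linked (same a c) (side a) (side c)
                  + linked (same a d) (side a) (side d) + linked (same b c) (side b) (side c)
                  + linked (same b d) (side b) (side d) + linked (same c d) (side c) (side d)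
    as-linked = cong₂ _+_ (cong₂ _+_ (cong₂ _+_ (cong₂ _+_ (cong₂ _+_
      (cong χ (adj-formula a b)) (cong χ (adj-formula a c))) (cong χ (adj-formula a d)))
      (cong χ (adj-formula b c))) (cong χ (adj-formula b d))) (cong χ (adj-formula c d))
  ... | inj₁ abc = not-crowded a≢b a≢c b≢c abc
  ... | inj₂ rest with Equivalence.to BoolP.T-∨ rest
  ...   | inj₁ abd = not-crowded a≢b a≢d b≢d abd
  ...   | inj₂ rest′ with Equivalence.to BoolP.T-∨ rest′
  ...     | inj₁ acd = not-crowded a≢c a≢d c≢d acd
  ...     | inj₂ bcd = not-crowded b≢c b≢d c≢d bcd

-- Counting vertices: J ⊕ q·C₄ has |J| + 4q vertices, so a decomposition of
-- a graph on n vertices with |J| < 4 has q = n / 4.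
copies-size : ∀ q → Vertex (copies q C₄) ↔ Fin (q * 4)
copies-size zero = ↔-sym FinP.0↔⊥
copies-size (suc q) = ↔-trans (↔-refl ⊎-↔ copies-size q) (↔-sym (FinP.+↔⊎ {4}))

squares-count : ∀ {n j q} {J : Graph} → Fin n ↔ Vertex (J ⊕ copies q C₄) → Vertex J ↔ Fin j → j < 4 → q ≡ n / 4
squares-count {n} {j} {q} vertices J-size j<4 = sym (begin
  n / 4            ≡⟨ cong (_/ 4) n≡j+4q ⟩
  (j + q * 4) / 4  ≡⟨ DivMod.+-distrib-/-∣ʳ j (Div.divides-refl q) ⟩
  j / 4 + q * 4 / 4 ≡⟨ cong₂ _+_ (DivMod.m<n⇒m/n≡0 j<4) (DivMod.m*n/n≡m q 4) ⟩
  q                ∎)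
  where
  open ≡-Reasoning
  n≡j+4q : n ≡ j + q * 4
  n≡j+4q = ↔⇒≡ (↔-trans vertices (↔-trans (J-size ⊎-↔ copies-size q) (↔-sym (FinP.+↔⊎ {j}))))

-- h(n) − 1 is n or n − 1, so the degree sum 2(h(n) − 1) is 2n or 2n − 2.
h∸1 : ∀ n → h n ∸ 1 ≡ n ⊎ suc (h n ∸ 1) ≡ n
h∸1 n with (n % 4) ℕ.≡ᵇ 0
... | true = inj₁ refl
h∸1 zero | false = inj₁ refl
h∸1 (suc k) | false = inj₂ refl

degree-sum : ∀ n m {s} → s ≡ m + m → m ≡ n ⊎ suc m ≡ n → s ≡ n * 2 ⊎ s + 2 ≡ n * 2
degree-sum n m refl (inj₁ refl) = inj₁ (trans (cong (m +_) (sym (ℕP.+-identityʳ m))) (ℕP.*-comm 2 m))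
degree-sum n m refl (inj₂ refl) = inj₂ (begin
  m + m + 2          ≡⟨ solve 1 (λ m → m :+ m :+ con 2 := (con 1 :+ m) :* con 2) refl m ⟩
  suc m * 2          ∎)
  where open ≡-Reasoning

-- The two directions of the theorem for a fixed weighting f.
module Directions {n : ℕ} (f : Weighting n) where
  open PositiveGraph f
  open SimpleGraphProps positive
  open Pieces positive

  -- posGraph f is the positive graph, which is its induced subgraph on all vertices.
  posGraph≅positive : posGraph f ≅ asGraph positive
  posGraph≅positive = ↔-refl , posGraph-adj

  positive≅induced : asGraph positive ≅ induced everything
  positive≅induced = mk↔ₛ′ (λ v → v , refl) proj₁ (λ (v , v∈) → cong (v ,_) (bool-irrelevant refl v∈)) (λ _ → refl)
                   , λ _ _ → ⇔-id _

  -- A decomposition J ⊕ q·C₄ with |J| < 4 is the one of the statement.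
  decomposition⇒statement : ∀ {J j} → Vertex J ↔ Fin j → j < 4 → Decomposition J → posGraph f ≅ (J ⊕ copies (n / 4) C₄)
  decomposition⇒statement {J} J-size j<4 (q , G≅) =
    subst (λ k → posGraph f ≅ (J ⊕ copies k C₄)) (squares-count {q = q} {J} (proj₁ f≅) J-size j<4) f≅
    where
    f≅ : posGraph f ≅ (J ⊕ copies q C₄)
    f≅ = ≅-trans {posGraph f} {induced everything} {J ⊕ copies q C₄}
           (≅-trans {posGraph f} {asGraph positive} {induced everything} posGraph≅positive positive≅induced) G≅

  -- The four decompositions of the statement.
  Decomposed : Set
  Decomposed = (posGraph f ≅ (emptyGraph ⊕ copies (n / 4) C₄)) ⊎ (posGraph f ≅ (K₁ ⊕ copies (n / 4) C₄))
             ⊎ (posGraph f ≅ (K₂ ⊕ copies (n / 4) C₄)) ⊎ (posGraph f ≅ (P₂ ⊕ copies (n / 4) C₄))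

  -- If no four vertices span three positive edges and the degree sum is 2n
  -- or 2n − 2, the positive graph is decomposed as in the statement.
  decomposed : 5 ≤ n → NoThreeEdges → sum deg ≡ n * 2 ⊎ sum deg + 2 ≡ n * 2 → Decomposed
  decomposed 5≤n noThree deg-sum = by-degree-sum deg-sum
    where
    sparse : sum deg ≤ n * 2
    sparse = [ ℕP.≤-reflexive , (λ e → ℕP.≤-trans (ℕP.m≤m+n (sum deg) 2) (ℕP.≤-reflexive e)) ]′ deg-sum
    open Classification positive 5≤n noThree sparse
    by-degree-sum : sum deg ≡ n * 2 ⊎ sum deg + 2 ≡ n * 2 → Decomposed
    by-degree-sum (inj₁ regular) = inj₁ (decomposition⇒statement (↔-sym FinP.0↔⊥) (s≤s z≤n) (regular-case regular))
    by-degree-sum (inj₂ deficient) = inj₂ (Sum.map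
      (decomposition⇒statement (↔-sym FinP.1↔⊤) (s≤s (s≤s z≤n)))
      (Sum.map (decomposition⇒statement ↔-refl (s≤s (s≤s (s≤s z≤n))))
                    (decomposition⇒statement ↔-refl (s≤s (s≤s (s≤s (s≤s z≤n)))))) (deficient-case deficient))

  -- Conversely, such a decomposition is labelled, hence has no zero-sum K₄.
  decomposition⇒no-zero-sum : ∀ {J q} → Bipartite≤2 J → posGraph f ≅ (J ⊕ copies q C₄) → ¬ ZeroSumK4 f
  decomposition⇒no-zero-sum {J} {q} J-bipartite f≅ =
    Equivalence.from no-zero-sum⇔noThree (LabelledNoThree.labelled⇒noThree positive
      (transport-labelled (≅-trans {asGraph positive} {posGraph f} {J ⊕ copies q C₄} positive≅posGraph f≅)
        (⊕-labelled J-bipartite (copies-labelled C₄-bipartite q))))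
    where
    positive≅posGraph : asGraph positive ≅ posGraph f
    positive≅posGraph = ↔-refl , λ u v → ⇔-sym (posGraph-adj u v)

  -- All four components J are complete bipartite with sides of size ≤ 2.
  decomposed⇒no-zero-sum : Decomposed → ¬ ZeroSumK4 f
  decomposed⇒no-zero-sum =
    [ decomposition⇒no-zero-sum {q = n / 4} ∅-bipartite
    , [ decomposition⇒no-zero-sum {q = n / 4} K₁-bipartite
      , [ decomposition⇒no-zero-sum {q = n / 4} K₂-bipartite
        , decomposition⇒no-zero-sum {q = n / 4} P₂-bipartite ]′ ]′ ]′

-- The theorem: no zero-sum K₄ means no four vertices spanning three positive
-- edges; the handshake lemma turns the edge count h(n) − 1 into the degree
-- sum, and the two directions above apply.
theorem8 : (n : ℕ) → 5 ≤ n → (f : Weighting n) → PosCount f (h n ∸ 1) →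
    (¬ ZeroSumK4 f) ⇔
      ( (posGraph f ≅ (emptyGraph ⊕ copies (n / 4) C₄))
      ⊎ (posGraph f ≅ (K₁ ⊕ copies (n / 4) C₄))
      ⊎ (posGraph f ≅ (K₂ ⊕ copies (n / 4) C₄))
      ⊎ (posGraph f ≅ (P₂ ⊕ copies (n / 4) C₄)) )
theorem8 n 5≤n f count = mk⇔
  (λ no-zero → decomposed 5≤n (Equivalence.to no-zero-sum⇔noThree no-zero)
                 (degree-sum n (h n ∸ 1) (handshake count) (h∸1 n)))
  decomposed⇒no-zero-sum
  where
  open PositiveGraph f
  open Directions f
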